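{- Let $Q$ be a quiver with $3$ vertices. If $Q$ is not mutation-acyclic, then no quiver in $\mathrm{mut}(Q)$ has a maximal green sequence. In all cases, there are at most $6$ quivers, up to isomorphism (relabelling of vertices), in $\mathrm{mut}(Q)$ that admit a maximal green sequence.
   Context: A quiver is a finite directed multigraph with no loops and no oriented 2-cycles. Mutation $\mu_k$: for every path $i\to k\to j$ add an arrow $i\to j$, reverse all arrows at $k$, delete a maximal collection of oriented 2-cycles. $\mathrm{mut}(Q)$ is the set of quivers obtained from $Q$ by sequences of mutations. A quiver is acyclic if it has no oriented cycles; $Q$ is mutation-acyclic if $\mathrm{mut}(Q)$ contains an acyclic quiver. Maximal green sequences: the framed quiver $\hat Q$ adds, for each vertex $i$, a frozen vertex $i'$ and an arrow $i\to i'$ (frozen vertices are never mutated; arrows between frozen vertices are discarded). A non-frozen vertex $i$ of a quiver obtained from $\hat Q$ by mutations is green if there is no arrow $j'\to i$ from a frozen vertex, red if there is no arrow $i\to j'$. A sequence $(i_1,\dots,i_l)$ is a maximal green sequence for $Q$ if each $i_t$ is green in $\mu_{i_{t-1}}\cdots\mu_{i_1}(\hat Q)$ and all non-frozen vertices of $\mu_{i_l}\cdots\mu_{i_1}(\hat Q)$ are red. -}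

module Defs where

open import Data.Nat using (ℕ; zero; suc; _+_; _*_; _∸_; _≤_)
open import Data.Fin using (Fin)
open import Data.Fin.Properties using () renaming (_≟_ to _≟F_)
open import Data.Sum using (_⊎_; inj₁; inj₂)
open import Data.Sum.Properties using (≡-dec)
open import Data.Product using (Σ; _×_; ∃)
open import Data.List using (List; []; _∷_)
open import Relation.Binary.PropositionalEquality using (_≡_)
open import Relation.Binary.Definitions using (DecidableEquality)
open import Relation.Nullary using (¬_; yes; no)
open import Function.Bundles using (_↔_; Inverse)

-- A (multi)quiver on vertex set V is given by its arrow counts:
-- a i j = number of arrows i → j.
Arrows : Set → Set
Arrows V = V → V → ℕ

IsQuiver : ∀ {n} → Arrows (Fin n) → Set
IsQuiver a = (∀ i → a i i ≡ 0) × (∀ i j → (a i j ≡ 0) ⊎ (a j i ≡ 0))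

-- Mutation at k: for i,j ≠ k, add a i k * a k j arrows i → j, then cancel
-- a maximal collection of oriented 2-cycles between i and j (truncated
-- subtraction keeps the surplus); arrows at k are reversed.
mutate : ∀ {V : Set} → DecidableEquality V → V → Arrows V → Arrows V
mutate _≟_ k a i j with i ≟ k | j ≟ k
... | yes _ | _     = a j i
... | no _  | yes _ = a j i
... | no _  | no _  = (a i j + a i k * a k j) ∸ (a j i + a j k * a k i)

μ : ∀ {n} → Fin n → Arrows (Fin n) → Arrows (Fin n)
μ = mutate _≟F_

mutSeq : ∀ {n} → List (Fin n) → Arrows (Fin n) → Arrows (Fin n)
mutSeq []       a = a
mutSeq (k ∷ ks) a = mutSeq ks (μ k a)

InMut : ∀ {n} → Arrows (Fin n) → Arrows (Fin n) → Set
InMut {n} a b = Σ (List (Fin n)) λ ks → ∀ i j → mutSeq ks a i j ≡ b i j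

data Path {n} (a : Arrows (Fin n)) : Fin n → Fin n → Set where
  edge : ∀ {i j} → 1 ≤ a i j → Path a i j
  step : ∀ {i k j} → 1 ≤ a i k → Path a k j → Path a i j

Acyclic : ∀ {n} → Arrows (Fin n) → Set
Acyclic a = ∀ i → ¬ Path a i i

MutationAcyclic : ∀ {n} → Arrows (Fin n) → Set
MutationAcyclic a = Σ _ λ b → InMut a b × Acyclic b

-- Framed quiver: vertices inj₁ i (mutable) and inj₂ i (frozen i').
FVert : ℕ → Set
FVert n = Fin n ⊎ Fin n

framed : ∀ {n} → Arrows (Fin n) → Arrows (FVert n)
framed a (inj₁ i) (inj₁ j) = a i j
framed a (inj₁ i) (inj₂ j) with i ≟F j
... | yes _ = 1
... | no _  = 0
framed a (inj₂ i) _ = 0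

dropFrozen : ∀ {n} → Arrows (FVert n) → Arrows (FVert n)
dropFrozen b (inj₂ i) (inj₂ j) = 0
dropFrozen b i j = b i j

fmut : ∀ {n} → Fin n → Arrows (FVert n) → Arrows (FVert n)
fmut k b = dropFrozen (mutate (≡-dec _≟F_ _≟F_) (inj₁ k) b)

Green : ∀ {n} → Arrows (FVert n) → Fin n → Set
Green b i = ∀ j → b (inj₂ j) (inj₁ i) ≡ 0

Red : ∀ {n} → Arrows (FVert n) → Fin n → Set
Red b i = ∀ j → b (inj₁ i) (inj₂ j) ≡ 0

IsMGSFrom : ∀ {n} → Arrows (FVert n) → List (Fin n) → Set
IsMGSFrom b []       = ∀ i → Red b i
IsMGSFrom b (k ∷ ks) = Green b k × IsMGSFrom (fmut k b) ks

HasMGS : ∀ {n} → Arrows (Fin n) → Set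
HasMGS {n} a = Σ (List (Fin n)) λ ks → IsMGSFrom (framed a) ks

Iso : ∀ {n} → Arrows (Fin n) → Arrows (Fin n) → Set
Iso {n} a b = Σ (Fin n ↔ Fin n) λ σ → ∀ i j → b (Inverse.to σ i) (Inverse.to σ j) ≡ a i j

{-# OPTIONS --safe #-}
module Submission where

-- A quiver on three vertices is a triple of signed multiplicities (b₁₂ , b₂₃ , b₃₁) up to
-- relabelling.  Call a cyclic quiver abundant if its three multiplicities are at least 2.
--
-- An abundant quiver has no maximal green sequence.  After the first green mutation there are
-- arrows A → B of multiplicity n ≥ 2 with c_A ≤ 0 ≤ c_A + c_B: the walls of this Kronecker pair
-- have been crossed in the wrong order.  Then A is not green, B is not red, and mutating at B
-- exchanges the roles of A and B.  Only mutations at the third vertex J can destroy the pair;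
-- following them leads to finitely many kinds of configurations, closed under green mutation
-- and none of them all red, because in each some sum of c-vectors, nonzero by linear
-- independence, is nonnegative.
--
-- A cyclic quiver that is not abundant has a simple arrow and is one mutation away from an
-- acyclic one.  This gives the first claim.  For the second, replace the largest multiplicity z
-- of a cyclic quiver by x y − z as long as this decreases it.  Either this stops at a cyclic
-- quiver with 2 z ≤ x y, and then the whole class is abundant, or it reaches an acyclic quiver
-- with multiplicities p, q, r.  In the latter case every further member of the class outside
-- a list of six is obtained by growing mutations, hence is abundant.  The six quivers
-- are the three acyclic ones p, q, r rotated under source and sink mutations together with their
-- mutations at the middle vertex; if exactly one of p, q, r vanishes they are four and two.

open import Defs
open import Data.Empty using (⊥; ⊥-elim)
open import Data.Fin using (Fin; toℕ)
open import Data.Fin.Patterns using (0F; 1F; 2F)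
open import Data.Fin.Properties using () renaming (_≟_ to _≟F_)
open import Data.Integer using (ℤ; +_; -[1+_]; 0ℤ; 1ℤ; -1ℤ; _+_; _*_; -_; _-_; _⊔_; +≤+; ∣_∣)
  renaming (_≤_ to _≤ᶻ_)
open import Data.Integer.Properties
  using (+-mono-≤; neg-mono-≤; neg-involutive; ≤-antisym; pos-+; pos-*; m-n≡m⊖n; [1+m]⊖[1+n]≡m⊖n;
         i≥j⇒i⊔j≡i; i≤j⇒i⊔j≡j)
open import Data.Integer.Tactic.RingSolver using (solve)
open import Data.List using (List; []; _∷_; _∷ʳ_; length; map)
open import Data.List.Membership.Propositional using (_∈_)
open import Data.List.Properties using (length-map)
open import Data.List.Relation.Unary.Any as Any using (Any; here; there)
open import Data.List.Relation.Unary.Any.Properties using (map⁺)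
open import Data.Nat as ℕ using (ℕ; _≤_; z≤n; s≤s)
open import Data.Nat.Properties using (m≤n⇒m∸n≡0; n∸n≡0; <-trans; <-irrefl)
  renaming (≤-refl to ≤-reflℕ; ≤-total to ≤-totalℕ)
open import Data.Product using (Σ; _×_; _,_; proj₁; proj₂)
open import Data.Sum using (_⊎_; inj₁; inj₂) renaming (map to ⊎-map; map₁ to ⊎-map₁; swap to ⊎-swap)
open import Data.Sum.Properties using (≡-dec)
open import Function using (_∘_)
open import Function.Bundles using (_↔_; Inverse; mk↔ₛ′)
open import Function.Construct.Composition using (_↔-∘_)
open import Function.Construct.Identity using (↔-id)
open import Relation.Binary.Definitions using (DecidableEquality)
open import Relation.Binary.PropositionalEquality using (_≡_; _≢_; refl; sym; trans; cong; cong₂; subst)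
open import Relation.Nullary using (¬_; yes; no)

-- Sign calculus on ℤ

infix 4 0≤_
0≤_ : ℤ → Set
0≤ x = 0ℤ ≤ᶻ x

infixl 6 _⊕_
infixl 7 _⊗_

_⊕_ : ∀ {x y} → 0≤ x → 0≤ y → 0≤ x + y
_⊕_ = +-mono-≤

_⊗_ : ∀ {x y} → 0≤ x → 0≤ y → 0≤ x * y
_⊗_ {+ m} {+ n} _ _ = subst 0≤_ (pos-* m n) (+≤+ z≤n)

0≤1 : 0≤ 1ℤ
0≤1 = +≤+ z≤n

0≤0 : 0≤ 0ℤ
0≤0 = +≤+ z≤n

-- Inequalities are mostly proved by certificates: `x` is a sum of products of quantities known to
-- be nonnegative, and the equation `y ≡ x` is left to the ring solver. That `x` is negative is
-- written `0≤ - x - 1ℤ`, and contradictions exhibit `-1ℤ` as such a sum.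
by : ∀ {x y} → 0ℤ ≤ᶻ x → y ≡ x → 0ℤ ≤ᶻ y
by h refl = h

0≰-1 : ¬ (0≤ -1ℤ)
0≰-1 ()

sign-split : ∀ x → 0≤ x ⊎ 0≤ - x - 1ℤ
sign-split (+ n)    = inj₁ (+≤+ z≤n)
sign-split -[1+ n ] = inj₂ (+≤+ z≤n)

one-split : ∀ {x} → 0≤ x - 1ℤ → x ≡ 1ℤ ⊎ 0≤ x - + 2
one-split {+ 0} ()
one-split {+ 1} _ = inj₁ refl
one-split {+ (ℕ.suc (ℕ.suc n))} _ = inj₂ (+≤+ z≤n)
one-split { -[1+ n ]} ()

0≤-- : ∀ {x} → 0≤ x → 0≤ - - x
0≤-- {x} h = by h (neg-involutive x)

0≤-pred : ∀ {x} k → 0≤ x - + k → 0≤ x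
0≤-pred {x} k h = by (h ⊕ +≤+ {n = k} z≤n) (cancel x (+ k))
  where
  cancel : ∀ x k → x ≡ x - k + k
  cancel x k = solve (x ∷ k ∷ [])

⁺-nonneg : ∀ {x} → 0≤ x → x ⊔ 0ℤ ≡ x
⁺-nonneg = i≥j⇒i⊔j≡i

⁺-nonpos : ∀ {x} → 0≤ - x → x ⊔ 0ℤ ≡ 0ℤ
⁺-nonpos {x} h = i≤j⇒i⊔j≡j (subst (_≤ᶻ 0ℤ) (neg-involutive x) (neg-mono-≤ h))

-- Seeds and green mutation

Coords : Set
Coords = Fin 3 → ℤ

Nonneg : Coords → Set
Nonneg c = ∀ t → 0≤ c t

-- eᵢⱼ is the number of arrows i → j minus that of arrows j → i; cᵢ t is the number of arrows
-- from i to the frozen vertex t′ minus that of arrows back (the c-vector of i).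
record Seed : Set where
  constructor seed
  field
    e₁₂ e₂₃ e₃₁ : ℤ
    c₁ c₂ c₃ : Coords

open Seed

rot : Seed → Seed
rot (seed p q r a b c) = seed q r p b c a

flip : Seed → Seed
flip (seed p q r a b c) = seed (- q) (- p) (- r) c b a

-- Mutation at the middle vertex 2; the formula for the c-vectors is correct only if 2 is green.
mid : Seed → Seed
mid (seed p q r a b c) = seed (- p) (- q) (r - (p ⊔ 0ℤ) * (q ⊔ 0ℤ) + (- p ⊔ 0ℤ) * (- q ⊔ 0ℤ))
  (λ t → a t + (p ⊔ 0ℤ) * b t) (λ t → - b t) (λ t → c t + (- q ⊔ 0ℤ) * b t)

seed-cong : ∀ {p p′ q q′ r r′ a b c} → p ≡ p′ → q ≡ q′ → r ≡ r′ → seed p q r a b c ≡ seed p′ q′ r′ a b c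
seed-cong refl refl refl = refl

mid-flip : ∀ s → mid (flip s) ≡ flip (mid s)
mid-flip (seed p q r a b c) rewrite neg-involutive p | neg-involutive q =
  seed-cong refl refl (lemma r (p ⊔ 0ℤ) (q ⊔ 0ℤ) (- p ⊔ 0ℤ) (- q ⊔ 0ℤ))
  where
  lemma : ∀ r p q p′ q′ → - r - q′ * p′ + q * p ≡ - (r - p * q + p′ * q′)
  lemma r p q p′ q′ = solve (r ∷ p ∷ q ∷ p′ ∷ q′ ∷ [])

Independent : Seed → Set
Independent s = ∀ α β γ → (∀ t → α * c₁ s t + β * c₂ s t + γ * c₃ s t ≡ 0ℤ) → α ≡ 0ℤ × β ≡ 0ℤ × γ ≡ 0ℤ

ind-rot : ∀ {s} → Independent s → Independent (rot s)
ind-rot {s} ind α β γ h with ind γ α β (λ t → trans (turn α β γ (c₁ s t) (c₂ s t) (c₃ s t)) (h t))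
  where
  turn : ∀ α β γ a b c → γ * a + α * b + β * c ≡ α * b + β * c + γ * a
  turn α β γ a b c = solve (α ∷ β ∷ γ ∷ a ∷ b ∷ c ∷ [])
... | z₁ , z₂ , z₃ = z₂ , z₃ , z₁

ind-flip : ∀ {s} → Independent s → Independent (flip s)
ind-flip {s} ind α β γ h with ind γ β α (λ t → trans (turn α β γ (c₁ s t) (c₂ s t) (c₃ s t)) (h t))
  where
  turn : ∀ α β γ a b c → γ * a + β * b + α * c ≡ α * c + β * b + γ * a
  turn α β γ a b c = solve (α ∷ β ∷ γ ∷ a ∷ b ∷ c ∷ [])
... | z₁ , z₂ , z₃ = z₃ , z₂ , z₁

-- Green mutation is a unimodular change of basis: a relation with coefficients α, β, γ among the
-- new vectors is one with coefficients α, αx + γy - β, γ among the old ones, where x and y are the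
-- positive parts in `mid`.
ind-mid : ∀ {s} → Independent s → Independent (mid s)
ind-mid {seed p q r a b c} ind α β γ h
  with ind α (α * (p ⊔ 0ℤ) + γ * (- q ⊔ 0ℤ) - β) γ
         (λ t → trans (expand (p ⊔ 0ℤ) (- q ⊔ 0ℤ) α β γ (a t) (b t) (c t)) (h t))
  where
  expand : ∀ x y α β γ a b c →
    α * a + (α * x + γ * y - β) * b + γ * c ≡ α * (a + x * b) + β * (- b) + γ * (c + y * b)
  expand x y α β γ a b c = solve (x ∷ y ∷ α ∷ β ∷ γ ∷ a ∷ b ∷ c ∷ [])
... | refl , z , refl = refl , trans (sym (neg-involutive β)) (cong -_ (trans (drop (p ⊔ 0ℤ) (- q ⊔ 0ℤ) β) z)) , refl
  where
  drop : ∀ x y β → - β ≡ 0ℤ * x + 0ℤ * y - β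
  drop x y β = solve (x ∷ y ∷ β ∷ [])

vanish : ∀ {x} → 0≤ x → 0≤ - x → x ≡ 0ℤ
vanish {x} h k = ≤-antisym (subst (_≤ᶻ 0ℤ) (neg-involutive x) (neg-mono-≤ k)) h

-- No vertex is green and red at once; this discards the mutations at vertices known to be red.
c₁≢0 : ∀ {s} → Independent s → Nonneg (c₁ s) → Nonneg (λ t → - c₁ s t) → ⊥
c₁≢0 {s} ind h k with ind 1ℤ 0ℤ 0ℤ (λ t → trans (pick (c₁ s t) (c₂ s t) (c₃ s t)) (vanish (h t) (k t)))
  where
  pick : ∀ a b c → 1ℤ * a + 0ℤ * b + 0ℤ * c ≡ a
  pick a b c = solve (a ∷ b ∷ c ∷ [])
... | () , _

c₃≢0 : ∀ {s} → Independent s → Nonneg (c₃ s) → Nonneg (λ t → - c₃ s t) → ⊥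
c₃≢0 {s} ind h k = c₁≢0 {rot (rot s)} (ind-rot {rot s} (ind-rot {s} ind)) h k

c₁+c₂≢0 : ∀ {s} → Independent s → Nonneg (λ t → c₁ s t + c₂ s t) →
  Nonneg (λ t → - c₁ s t) → Nonneg (λ t → - c₂ s t) → ⊥
c₁+c₂≢0 {s} ind h k₁ k₂ with ind 1ℤ 1ℤ 0ℤ (λ t → trans (pick (c₁ s t) (c₂ s t) (c₃ s t))
    (vanish (h t) (by (k₁ t ⊕ k₂ t) (neg (c₁ s t) (c₂ s t)))))
  where
  pick : ∀ a b c → 1ℤ * a + 1ℤ * b + 0ℤ * c ≡ a + b
  pick a b c = solve (a ∷ b ∷ c ∷ [])
  neg : ∀ a b → - (a + b) ≡ - a + - b
  neg a b = solve (a ∷ b ∷ [])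
... | () , _

c₁+c₂+c₃≢0 : ∀ {s} → Independent s → Nonneg (λ t → c₁ s t + c₂ s t + c₃ s t) →
  Nonneg (λ t → - c₁ s t) → Nonneg (λ t → - c₂ s t) → Nonneg (λ t → - c₃ s t) → ⊥
c₁+c₂+c₃≢0 {s} ind h k₁ k₂ k₃ with ind 1ℤ 1ℤ 1ℤ (λ t → trans (pick (c₁ s t) (c₂ s t) (c₃ s t))
    (vanish (h t) (by (k₁ t ⊕ k₂ t ⊕ k₃ t) (neg (c₁ s t) (c₂ s t) (c₃ s t)))))
  where
  pick : ∀ a b c → 1ℤ * a + 1ℤ * b + 1ℤ * c ≡ a + b + c
  pick a b c = solve (a ∷ b ∷ c ∷ [])
  neg : ∀ a b c → - (a + b + c) ≡ - a + - b + - c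
  neg a b c = solve (a ∷ b ∷ c ∷ [])
... | () , _

-- Green mutation from an abundant quiver

record Pair (n : ℤ) (a b : Coords) : Set where
  constructor pair
  field
    mult : 0≤ n - + 2
    red  : Nonneg (λ t → - a t)
    dom  : Nonneg (λ t → a t + b t)

-- The vertices are listed in the order A, B, J.  `above`, `between` and `below` describe where J
-- sits relative to A → B (J → A or no arrow, A → J but not B → J, both A → J and B → J), the
-- alternative in the last two being what is needed after a mutation at J.  In `trapped` J is red
-- for ever.  The split states follow a mutation at J along a simple arrow: the Kronecker pair
-- persists as (c_A + c_J , c_B), respectively (c_A , c_B + c_J), instead of (c_A , c_B).
data State : Seed → Set where
  initial : ∀ {n v u a b c} → 0≤ n - + 2 → 0≤ v - + 2 → 0≤ u - + 2 →
    Nonneg a → Nonneg b → Nonneg c → State (seed n v u a b c)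
  above : ∀ {n v u a b c} → Pair n a b → 0≤ u → Nonneg (λ t → b t + c t) → State (seed n v u a b c)
  between : ∀ {n v u a b c} → Pair n a b → 0≤ - u - 1ℤ → 0≤ - v → Nonneg (λ t → b t + c t) →
    u ≡ -1ℤ ⊎ 0≤ - u - + 2 × (Nonneg (λ t → (- u - 1ℤ) * c t + a t) ⊎ Nonneg (λ t → - c t)) →
    State (seed n v u a b c)
  below : ∀ {n v u a b c} → Pair n a b → 0≤ - u - 1ℤ → 0≤ v - 1ℤ → Nonneg c →
    u ≡ -1ℤ ⊎ 0≤ - u - + 2 × Nonneg (λ t → (- u - 1ℤ) * c t + a t) → State (seed n v u a b c)
  trapped : ∀ {n v u a b c} → Pair n a b → Nonneg (λ t → - c t) → 0≤ v → 0≤ v - u → State (seed n v u a b c)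
  detached : ∀ {n v u a b c} → Pair n a b → 0≤ - u → v ≡ -1ℤ →
    Nonneg (λ t → - c t) → Nonneg (λ t → - (b t + c t)) → State (seed n v u a b c)
  splitA : ∀ {n v u a b c} → 0≤ n - 1ℤ → 0≤ n - v - + 2 → 0≤ v + 1ℤ → u ≡ 1ℤ →
    Nonneg (λ t → - c t) → Nonneg (λ t → - (a t + c t)) → Nonneg (λ t → a t + b t + c t) →
    State (seed n v u a b c)
  splitB : ∀ {n v u a b c} → 0≤ 1ℤ - n → v ≡ -1ℤ → 0≤ - u - 1ℤ → 0≤ n - u - + 2 →
    Nonneg (λ t → - a t) → Nonneg (λ t → - c t) → Nonneg (λ t → a t + b t + c t) → State (seed n v u a b c)
  splitB′ : ∀ {n v u a b c} → n ≡ 1ℤ → v ≡ -1ℤ → u ≡ -1ℤ →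
    Nonneg (λ t → - a t) → Nonneg (λ t → - (a t + c t)) → Nonneg (λ t → a t + b t + c t) →
    State (seed n v u a b c)

-- The closure under relabelling lets each configuration be listed in one order only.
data Safe : Seed → Set where
  base  : ∀ {s} → State s → Safe s
  rotˢ  : ∀ {s} → Safe (rot s) → Safe s
  flipˢ : ∀ {s} → Safe (flip s) → Safe s

-- Each rule evaluates the positive parts in `mid` for one sign pattern of `p` and `q`. For `p`
-- nonnegative the result is listed in the order 2, 1, 3, so that its first multiplicity is
-- nonnegative again. `Q` is any property invariant under relabelling.
module Moves (Q : Seed → Set)
  (rotQ : ∀ {s} → Q (rot s) → Q s) (flipQ : ∀ {s} → Q (flip s) → Q s) where

  mid⁺⁺ : ∀ {p q r a b c} → 0≤ p → 0≤ q →
    Q (seed p (p * q - r) q (λ t → - b t) (λ t → a t + p * b t) (λ t → c t + 0ℤ)) →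
    Q (mid (seed p q r a b c))
  mid⁺⁺ {p} {q} {r} hp hq h
    rewrite ⁺-nonneg hp | ⁺-nonneg hq | ⁺-nonpos (0≤-- hp) | ⁺-nonpos (0≤-- hq) =
    flipQ (rotQ (subst Q (seed-cong (sym (neg-involutive p)) (eq p q r) (sym (neg-involutive q))) h))
    where
    eq : ∀ p q r → p * q - r ≡ - (r - p * q + 0ℤ)
    eq p q r = solve (p ∷ q ∷ r ∷ [])

  mid⁺⁻ : ∀ {p q r a b c} → 0≤ p → 0≤ - q →
    Q (seed p (- r) q (λ t → - b t) (λ t → a t + p * b t) (λ t → c t + (- q) * b t)) →
    Q (mid (seed p q r a b c))
  mid⁺⁻ {p} {q} {r} hp hq h
    rewrite ⁺-nonneg hp | ⁺-nonpos hq | ⁺-nonpos (0≤-- hp) | ⁺-nonneg hq =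
    flipQ (rotQ (subst Q (seed-cong (sym (neg-involutive p)) (eq p q r) (sym (neg-involutive q))) h))
    where
    eq : ∀ p q r → - r ≡ - (r - p * 0ℤ + 0ℤ * (- q))
    eq p q r = solve (p ∷ q ∷ r ∷ [])

  mid⁻⁺ : ∀ {p q r a b c} → 0≤ - p → 0≤ q →
    Q (seed (- p) (- q) r (λ t → a t + 0ℤ) (λ t → - b t) (λ t → c t + 0ℤ)) →
    Q (mid (seed p q r a b c))
  mid⁻⁺ {p} {q} {r} hp hq h
    rewrite ⁺-nonpos hp | ⁺-nonneg hp | ⁺-nonpos (0≤-- hq) =
    subst Q (seed-cong refl refl (eq p q r)) h
    where
    eq : ∀ p q r → r ≡ r - 0ℤ + (- p) * 0ℤ
    eq p q r = solve (p ∷ q ∷ r ∷ [])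

  mid⁻⁻ : ∀ {p q r a b c} → 0≤ - p → 0≤ - q →
    Q (seed (- p) (- q) (r + p * q) (λ t → a t + 0ℤ) (λ t → - b t) (λ t → c t + (- q) * b t)) →
    Q (mid (seed p q r a b c))
  mid⁻⁻ {p} {q} {r} hp hq h
    rewrite ⁺-nonpos hp | ⁺-nonneg hp | ⁺-nonneg hq =
    subst Q (seed-cong refl refl (eq p q r)) h
    where
    eq : ∀ p q r → r + p * q ≡ r - 0ℤ + (- p) * (- q)
    eq p q r = solve (p ∷ q ∷ r ∷ [])

open Moves Safe rotˢ flipˢ public

dom⇒0≤ : ∀ {a b} → 0≤ - a → 0≤ a + b → 0≤ b
dom⇒0≤ {a} {b} h k = by (h ⊕ k) (eq a b)
  where
  eq : ∀ a b → b ≡ - a + (a + b)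
  eq a b = solve (a ∷ b ∷ [])

b≥0 : ∀ {n a b} → Pair n a b → Nonneg b
b≥0 (pair _ r d) t = dom⇒0≤ (r t) (d t)

n≥0 : ∀ {n a b} → Pair n a b → 0≤ n
n≥0 p = 0≤-pred 2 (Pair.mult p)

-- After a mutation at B, B plays A and conversely. The sum of the two vectors becomes (c_A + c_B) +
-- (n - 2) c_B, which is where n ≥ 2 enters.
pair-swap : ∀ {n a b} → Pair n a b → Pair n (λ t → - b t) (λ t → a t + n * b t)
pair-swap {n} {a} {b} P@(pair m r d) =
  pair m (λ t → 0≤-- (b≥0 P t)) (λ t → by (d t ⊕ m ⊗ b≥0 P t) (eq n (a t) (b t)))
  where
  eq : ∀ n a b → - b + (a + n * b) ≡ (a + b) + (n - + 2) * b
  eq n a b = solve (n ∷ a ∷ b ∷ [])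

-- The mutations at 3 and 1 take place in the middle of a rotated seed and are not rotated back, a
-- difference that `Safe` does not see.
Step : Seed → Set
Step s = (Nonneg (c₂ s) → Safe (mid s)) × (Nonneg (c₃ s) → Safe (mid (rot s))) × (Nonneg (c₁ s) → Safe (mid (rot (rot s))))

-+0 : ∀ {x} → 0≤ - x → 0≤ - (x + 0ℤ)
-+0 {x} h = by h (eq x)
  where
  eq : ∀ x → - (x + 0ℤ) ≡ - x
  eq x = solve (x ∷ [])

tri-split : ∀ x → 0≤ - x ⊎ x ≡ 1ℤ ⊎ 0≤ x - + 2
tri-split (+ 0)                                   = inj₁ 0≤0
tri-split (+ 1)                                   = inj₂ (inj₁ refl)
tri-split (+ ℕ.suc (ℕ.suc n))       = inj₂ (inj₂ (+≤+ z≤n))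
tri-split -[1+ n ]                                = inj₁ (+≤+ z≤n)

neg-one : ∀ {x} → - x ≡ 1ℤ → x ≡ -1ℤ
neg-one {x} e = trans (sym (neg-involutive x)) (cong -_ e)

minus-one-split : ∀ {x} → 0≤ - x - 1ℤ → x ≡ -1ℤ ⊎ 0≤ - x - + 2
minus-one-split {x} h with one-split { - x} h
... | inj₁ e = inj₁ (neg-one e)
... | inj₂ k = inj₂ k

swap-above : ∀ {n v u a b c} → Pair n a b → 0≤ v → Nonneg (λ t → b t + c t) → Safe (mid (seed n v u a b c))
swap-above {n} {v} {u} {a} {b} {c} P@(pair m r d) v0 h =
  mid⁺⁺ {n} {v} {u} {a} {b} {c} (n≥0 P) v0 (base (above (pair-swap P) v0
    (λ t → by (d t ⊕ h t ⊕ m ⊗ b≥0 P t) (eq n (a t) (b t) (c t)))))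
  where
  eq : ∀ n a b c → a + n * b + (c + 0ℤ) ≡ (a + b) + (b + c) + (n - + 2) * b
  eq n a b c = solve (n ∷ a ∷ b ∷ c ∷ [])

-- With m arrows A → J, the quantity (m - 1) c_J + c_A is the `dom` of the pair that a mutation at J
-- would form from J and A, see `weak⇒dom`. Here it is evaluated after a mutation at B, when B plays
-- A and m is `- v`.
weak-swap : ∀ v b c → 0≤ - v - + 2 → 0≤ b → 0≤ b + c → 0≤ (- v - 1ℤ) * (c + (- v) * b) + (- b)
weak-swap v b c w b0 h = by ((w ⊕ 0≤1) ⊗ h ⊕ (w ⊗ w ⊕ (w ⊕ w)) ⊗ b0) (eq v b c)
  where
  eq : ∀ v b c → (- v - 1ℤ) * (c + (- v) * b) + (- b) ≡
    (- v - + 2 + 1ℤ) * (b + c) + ((- v - + 2) * (- v - + 2) + ((- v - + 2) + (- v - + 2))) * b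
  eq v b c = solve (v ∷ b ∷ c ∷ [])

step-initial : ∀ {n v u a b c} → 0≤ n - + 2 → 0≤ v - + 2 → 0≤ u - + 2 →
  Nonneg a → Nonneg b → Nonneg c → Safe (mid (seed n v u a b c))
step-initial {n} {v} {u} {a} {b} {c} n2 v2 u2 a0 b0 c0 =
  mid⁺⁺ {n} {v} {u} {a} {b} {c} n0 v0 (base (above
    (pair n2 (λ t → 0≤-- (b0 t)) (λ t → by (a0 t ⊕ b0 t ⊕ n2 ⊗ b0 t) (eq₁ n (a t) (b t))))
    v0 (λ t → by (a0 t ⊕ n0 ⊗ b0 t ⊕ c0 t) (eq₂ n (a t) (b t) (c t)))))
  where
  n0 = 0≤-pred 2 n2
  v0 = 0≤-pred 2 v2
  eq₁ : ∀ n a b → - b + (a + n * b) ≡ a + b + (n - + 2) * b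
  eq₁ n a b = solve (n ∷ a ∷ b ∷ [])
  eq₂ : ∀ n a b c → a + n * b + (c + 0ℤ) ≡ a + n * b + c
  eq₂ n a b c = solve (n ∷ a ∷ b ∷ c ∷ [])

above-mid : ∀ {n v u a b c} → Pair n a b → 0≤ u → Nonneg (λ t → b t + c t) → Safe (mid (seed n v u a b c))
above-mid {n} {v} {u} {a} {b} {c} P@(pair m r d) u0 h with sign-split v
... | inj₁ v0 = swap-above {u = u} P v0 h
... | inj₂ v1 = mid⁺⁻ {n} {v} {u} {a} {b} {c} (n≥0 P) (0≤-pred 1 v1) (base (between (pair-swap P) v1 (0≤-- u0)
    (λ t → by (d t ⊕ h t ⊕ m ⊗ b≥0 P t ⊕ 0≤-pred { - v} 1 v1 ⊗ b≥0 P t) (eq n v (a t) (b t) (c t))) (weak (minus-one-split v1))))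
  where
  eq : ∀ n v a b c → a + n * b + (c + (- v) * b) ≡ (a + b) + (b + c) + (n - + 2) * b + (- v) * b
  eq n v a b c = solve (n ∷ v ∷ a ∷ b ∷ c ∷ [])
  weak : v ≡ -1ℤ ⊎ 0≤ - v - + 2 → _
  weak (inj₁ e) = inj₁ e
  weak (inj₂ w) = inj₂ (w , inj₁ (λ t → weak-swap v (b t) (c t) w (b≥0 P t) (h t)))

above-last : ∀ {n v u a b c} → Pair n a b → 0≤ u → Nonneg (λ t → b t + c t) → Nonneg c →
  Safe (mid (rot (seed n v u a b c)))
above-last {n} {v} {u} {a} {b} {c} P@(pair m r d) u0 h g with tri-split v
-- No arrow ends at J, so its mutation changes no other c-vector and J merely turns red.
... | inj₁ v0 = mid⁻⁺ {v} {u} {n} {b} {c} {a} v0 u0 (rotˢ (rotˢ (base (trapped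
    (pair m (λ t → -+0 (r t)) (λ t → by (d t) (eq₁ (a t) (b t)))) (λ t → 0≤-- (g t)) v0 (v0 ⊕ 0≤-- u0)))))
  where
  eq₁ : ∀ a b → a + 0ℤ + (b + 0ℤ) ≡ a + b
  eq₁ a b = solve (a ∷ b ∷ [])
-- The multiple arrow B → J takes over: after the mutation J and B are the pair and A is the third
-- vertex.
... | inj₂ (inj₂ v2) = mid⁺⁺ {v} {u} {n} {b} {c} {a} v0 u0 (base (above
    (pair v2 (λ t → 0≤-- (g t)) (λ t → by (b≥0 P t ⊕ v2 ⊗ g t ⊕ g t) (eq₁ v (b t) (c t)))) u0
    (λ t → by (d t ⊕ v0 ⊗ g t) (eq₂ v (a t) (b t) (c t)))))
  where
  v0 = 0≤-pred 2 v2
  eq₁ : ∀ v b c → - c + (b + v * c) ≡ b + (v - + 2) * c + c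
  eq₁ v b c = solve (v ∷ b ∷ c ∷ [])
  eq₂ : ∀ v a b c → b + v * c + (a + 0ℤ) ≡ (a + b) + v * c
  eq₂ v a b c = solve (v ∷ a ∷ b ∷ c ∷ [])
-- For a simple arrow B → J the paths B → J → A lower the multiplicity of A → B from n to n - u. If
-- this is still at least 2, A and B remain a pair; otherwise the state is `splitB`, where the old
-- c_B is the sum of the new vectors of B and J.
... | inj₂ (inj₁ refl) = mid⁺⁺ {1ℤ} {u} {n} {b} {c} {a} 0≤1 u0 (flipˢ (base (after (sign-split (n - u - + 2)) (sign-split (- u)))))
  where
  eq₁ : ∀ n u → - (1ℤ * u - n) - + 2 ≡ n - u - + 2
  eq₁ n u = solve (n ∷ u ∷ [])
  eq₂ : ∀ a b c → a + 0ℤ + (b + 1ℤ * c) ≡ (a + b) + c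
  eq₂ a b c = solve (a ∷ b ∷ c ∷ [])
  eq₃ : ∀ b c → b + 1ℤ * c + (- c) ≡ b
  eq₃ b c = solve (b ∷ c ∷ [])
  eq₄ : ∀ n u → 1ℤ - (- (1ℤ * u - n)) ≡ - (n - u - + 2) - 1ℤ
  eq₄ n u = solve (n ∷ u ∷ [])
  eq₅ : ∀ n u → - (- u) - 1ℤ ≡ - (n - u - + 2) - 1ℤ + (n - + 2)
  eq₅ n u = solve (n ∷ u ∷ [])
  eq₆ : ∀ n u → - (1ℤ * u - n) - (- u) - + 2 ≡ n - + 2
  eq₆ n u = solve (n ∷ u ∷ [])
  eq₇ : ∀ a b c → a + 0ℤ + (b + 1ℤ * c) + (- c) ≡ a + b
  eq₇ a b c = solve (a ∷ b ∷ c ∷ [])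
  cond : ∀ {w} → - u ≡ -1ℤ ⊎ 0≤ - - u - + 2 → - u ≡ -1ℤ ⊎ 0≤ - - u - + 2 × (Nonneg w ⊎ Nonneg (λ t → - - c t))
  cond (inj₁ e) = inj₁ e
  cond (inj₂ k) = inj₂ (k , inj₂ (λ t → 0≤-- (g t)))
  H : Nonneg (λ t → b t + 1ℤ * c t + (- c t))
  H t = by (b≥0 P t) (eq₃ (b t) (c t))
  P′ : 0≤ n - u - + 2 → Pair (- (1ℤ * u - n)) (λ t → a t + 0ℤ) (λ t → b t + 1ℤ * c t)
  P′ k = pair (by k (eq₁ n u)) (λ t → -+0 (r t)) (λ t → by (d t ⊕ g t) (eq₂ (a t) (b t) (c t)))
  after : 0≤ n - u - + 2 ⊎ 0≤ - (n - u - + 2) - 1ℤ → 0≤ - u ⊎ 0≤ - - u - 1ℤ →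
    State (seed (- (1ℤ * u - n)) (- 1ℤ) (- u) (λ t → a t + 0ℤ) (λ t → b t + 1ℤ * c t) (λ t → - c t))
  after (inj₁ k) (inj₁ u≤0) = above (P′ k) u≤0 H
  after (inj₁ k) (inj₂ u≥1) = between (P′ k) u≥1 0≤1 H (cond (minus-one-split u≥1))
  after (inj₂ k) _ = splitB (by k (eq₄ n u)) refl (by (k ⊕ m) (eq₅ n u)) (by m (eq₆ n u))
    (λ t → -+0 (r t)) (λ t → 0≤-- (g t)) (λ t → by (d t) (eq₇ (a t) (b t) (c t)))

between-mid : ∀ {n v u a b c} → Pair n a b → 0≤ - u - 1ℤ → Nonneg (λ t → b t + c t) → Safe (mid (seed n v u a b c))
between-mid {n} {v} {u} {a} {b} {c} P@(pair m r d) u1 h with sign-split v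
... | inj₁ v0 = swap-above {u = u} P v0 h
... | inj₂ v1 = mid⁺⁻ {n} {v} {u} {a} {b} {c} (n≥0 P) (0≤-pred 1 v1) (base (below (pair-swap P) v1 u1
    (λ t → by (h t ⊕ v1 ⊗ b≥0 P t) (eq v (b t) (c t))) (weak (minus-one-split v1))))
  where
  eq : ∀ v b c → c + (- v) * b ≡ (b + c) + (- v - 1ℤ) * b
  eq v b c = solve (v ∷ b ∷ c ∷ [])
  weak : v ≡ -1ℤ ⊎ 0≤ - v - + 2 → _
  weak (inj₁ e) = inj₁ e
  weak (inj₂ w) = inj₂ (w , λ t → weak-swap v (b t) (c t) w (b≥0 P t) (h t))

-- The old c_A is the sum of the new vectors of A and J, and the old multiplicity n is the
-- difference of the new multiplicities of A → B and B → J; this is what `splitA` records.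
between-last-one : ∀ {n v a b c} → Pair n a b → 0≤ - v → Nonneg c → Safe (mid (rot (seed n v -1ℤ a b c)))
between-last-one {n} {v} {a} {b} {c} P@(pair m r d) v0 g =
  mid⁻⁻ {v} { -1ℤ} {n} {b} {c} {a} v0 0≤1 (rotˢ (rotˢ (base (splitA (by (m ⊕ v0 ⊕ 0≤1) (eq₁ n v)) (by m (eq₂ n v)) (v0 ⊕ 0≤1) refl
    (λ t → 0≤-- (g t)) (λ t → by (r t) (eq₃ (a t) (c t))) (λ t → by (d t) (eq₄ (a t) (b t) (c t)))))))
  where
  eq₁ : ∀ n v → n + v * -1ℤ - 1ℤ ≡ (n - + 2) + (- v) + 1ℤ
  eq₁ n v = solve (n ∷ v ∷ [])
  eq₂ : ∀ n v → n + v * -1ℤ - (- v) - + 2 ≡ n - + 2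
  eq₂ n v = solve (n ∷ v ∷ [])
  eq₃ : ∀ a c → - (a + 1ℤ * c + (- c)) ≡ - a
  eq₃ a c = solve (a ∷ c ∷ [])
  eq₄ : ∀ a b c → a + 1ℤ * c + (b + 0ℤ) + (- c) ≡ a + b
  eq₄ a b c = solve (a ∷ b ∷ c ∷ [])

weak⇒dom : ∀ u a c → 0≤ (- u - 1ℤ) * c + a → 0≤ - c + (a + (- u) * c)
weak⇒dom u a c w = by w (eq u a c)
  where
  eq : ∀ u a c → - c + (a + (- u) * c) ≡ (- u - 1ℤ) * c + a
  eq u a c = solve (u ∷ a ∷ c ∷ [])

between-last-two : ∀ {n v u a b c} → Pair n a b → 0≤ - v → 0≤ - u - + 2 → Nonneg (λ t → (- u - 1ℤ) * c t + a t) →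
  Nonneg c → Safe (mid (rot (seed n v u a b c)))
between-last-two {n} {v} {u} {a} {b} {c} P@(pair m r d) v0 u2 w g =
  mid⁻⁻ {v} {u} {n} {b} {c} {a} v0 u0 (rotˢ (base (above (pair u2 (λ t → 0≤-- (g t)) (λ t → weak⇒dom u (a t) (c t) (w t))) v0
    (λ t → by (d t ⊕ u0 ⊗ g t) (eq u (a t) (b t) (c t))))))
  where
  u0 = 0≤-pred 2 u2
  eq : ∀ u a b c → a + (- u) * c + (b + 0ℤ) ≡ (a + b) + (- u) * c
  eq u a b c = solve (u ∷ a ∷ b ∷ c ∷ [])

-- Both A and B have arrows to J. If B → J is multiple, J and B become the pair; if only A → J is, J
-- and A do; if both are simple, the old pair persists in split form.
below-last : ∀ {n v u a b c} → Pair n a b → 0≤ - u - 1ℤ → 0≤ v - 1ℤ →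
  u ≡ -1ℤ ⊎ 0≤ - u - + 2 × Nonneg (λ t → (- u - 1ℤ) * c t + a t) →
  Nonneg c → Safe (mid (rot (seed n v u a b c)))
below-last {n} {v} {u} {a} {b} {c} P@(pair m r d) u1 v1 w g =
  mid⁺⁻ {v} {u} {n} {b} {c} {a} v0 u0 (go (one-split v1) w)
  where
  u0 = 0≤-pred 1 u1
  v0 = 0≤-pred 1 v1
  target : ℤ → ℤ → Seed
  target v u = seed v (- n) u (λ t → - c t) (λ t → b t + v * c t) (λ t → a t + (- u) * c t)
  eq₁ : ∀ v b c → - c + (b + v * c) ≡ b + (v - + 2) * c + c
  eq₁ v b c = solve (v ∷ b ∷ c ∷ [])
  eq₂ : ∀ v u a b c → b + v * c + (a + (- u) * c) ≡ (a + b) + v * c + (- u) * c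
  eq₂ v u a b c = solve (v ∷ u ∷ a ∷ b ∷ c ∷ [])
  eq₃ : ∀ u a c → (- u - 1ℤ) * (a + (- u) * c) + (- c) ≡ (- u - 1ℤ) * ((- u - 1ℤ) * c + a) + (- u - + 2) * c
  eq₃ u a c = solve (u ∷ a ∷ c ∷ [])
  eq₄ : ∀ n → - - n - 1ℤ ≡ n - + 2 + 1ℤ
  eq₄ n = solve (n ∷ [])
  eq₅ : ∀ n → - - n - -1ℤ - + 2 ≡ n - + 2 + 1ℤ
  eq₅ n = solve (n ∷ [])
  eq₆ : ∀ a c → - (a + 1ℤ * c + (- c)) ≡ - a
  eq₆ a c = solve (a ∷ c ∷ [])
  eq₇ : ∀ a b c → a + 1ℤ * c + (b + 1ℤ * c) + (- c) ≡ (a + b) + c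
  eq₇ a b c = solve (a ∷ b ∷ c ∷ [])
  eq₈ : ∀ b c → b + 1ℤ * c ≡ b + c
  eq₈ b c = solve (b ∷ c ∷ [])
  go : v ≡ 1ℤ ⊎ 0≤ v - + 2 → u ≡ -1ℤ ⊎ 0≤ - u - + 2 × Nonneg (λ t → (- u - 1ℤ) * c t + a t) → Safe (target v u)
  go (inj₂ v2) w = base (between (pair v2 (λ t → 0≤-- (g t)) (λ t → by (b≥0 P t ⊕ v2 ⊗ g t ⊕ g t) (eq₁ v (b t) (c t))))
    u1 (0≤-- (n≥0 P)) (λ t → by (d t ⊕ v0 ⊗ g t ⊕ u0 ⊗ g t) (eq₂ v u (a t) (b t) (c t))) (weak w))
    where
    weak : u ≡ -1ℤ ⊎ 0≤ - u - + 2 × Nonneg (λ t → (- u - 1ℤ) * c t + a t) → _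
    weak (inj₁ e) = inj₁ e
    weak (inj₂ (k , w)) = inj₂ (k , inj₁ (λ t → by (u1 ⊗ w t ⊕ k ⊗ g t) (eq₃ u (a t) (c t))))
  go (inj₁ refl) (inj₁ refl) = flipˢ (base (splitA (by (m ⊕ 0≤1) (eq₄ n)) (by (m ⊕ 0≤1) (eq₅ n)) 0≤0 refl
    (λ t → 0≤-- (g t)) (λ t → by (r t) (eq₆ (a t) (c t))) (λ t → by (d t ⊕ g t) (eq₇ (a t) (b t) (c t)))))
  go (inj₁ refl) (inj₂ (k , w)) = flipˢ (rotˢ (rotˢ (base (below
    (pair k (λ t → 0≤-- (g t)) (λ t → weak⇒dom u (a t) (c t) (w t))) 0≤0 (by (m ⊕ 0≤1) (eq₄ n))
    (λ t → by (b≥0 P t ⊕ g t) (eq₈ (b t) (c t))) (inj₁ refl)))))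

-- A green mutation at B changes c_J only if there are arrows J → B. The bounds v ≥ 0 and v ≥ u are
-- reproduced by n v - u and v, so the mutations alternating between A and B never meet such arrows.
trapped-mid : ∀ {n v u a b c} → Pair n a b → Nonneg (λ t → - c t) → 0≤ v → 0≤ v - u → Safe (mid (seed n v u a b c))
trapped-mid {n} {v} {u} {a} {b} {c} P@(pair m r d) k v0 vu = mid⁺⁺ {n} {v} {u} {a} {b} {c} (n≥0 P) v0 (base (trapped (pair-swap P)
    (λ t → -+0 (k t)) (by (vu ⊕ v0 ⊕ m ⊗ v0) (eq₁ n v u)) (by (vu ⊕ m ⊗ v0) (eq₂ n v u))))
  where
  eq₁ : ∀ n v u → n * v - u ≡ (v - u) + v + (n - + 2) * v
  eq₁ n v u = solve (n ∷ v ∷ u ∷ [])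
  eq₂ : ∀ n v u → n * v - u - v ≡ (v - u) + (n - + 2) * v
  eq₂ n v u = solve (n ∷ v ∷ u ∷ [])

detached-mid : ∀ {n u a b c} → Pair n a b → 0≤ - u → Nonneg (λ t → - (b t + c t)) → Safe (mid (seed n -1ℤ u a b c))
detached-mid {n} {u} {a} {b} {c} P@(pair m r d) u0 k = mid⁺⁻ {n} { -1ℤ} {u} {a} {b} {c} (n≥0 P) 0≤1 (base (trapped (pair-swap P)
    (λ t → by (k t) (eq (b t) (c t))) u0 (u0 ⊕ 0≤1)))
  where
  eq : ∀ b c → - (c + 1ℤ * b) ≡ - (b + c)
  eq b c = solve (b ∷ c ∷ [])

-- As c_J ≤ 0, the sum condition yields c_A + c_B ≥ 0, so for n ≥ 2 the mutation at B produces a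
-- genuine pair. What remains is n = 1 with v = -1, which leads to `splitB′`.
splitA-mid : ∀ {n v a b c} → 0≤ n - 1ℤ → 0≤ n - v - + 2 → 0≤ v + 1ℤ →
  Nonneg (λ t → - c t) → Nonneg (λ t → a t + b t + c t) → Nonneg b → Safe (mid (seed n v 1ℤ a b c))
splitA-mid {n} {v} {a} {b} {c} n1 nv v1 k s g with sign-split v
... | inj₁ v0 = mid⁺⁺ {n} {v} {1ℤ} {a} {b} {c} n0 v0 (base (above (pair n2 (λ t → 0≤-- (g t))
    (λ t → by (s t ⊕ k t ⊕ n2 ⊗ g t) (eq₁ n (a t) (b t) (c t)))) v0
    (λ t → by (s t ⊕ n1 ⊗ g t) (eq₂ n (a t) (b t) (c t)))))
  where
  n0 = 0≤-pred 1 n1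
  eq₀ : ∀ n v → n - + 2 ≡ (n - v - + 2) + v
  eq₀ n v = solve (n ∷ v ∷ [])
  n2 = by (nv ⊕ v0) (eq₀ n v)
  eq₁ : ∀ n a b c → - b + (a + n * b) ≡ (a + b + c) + (- c) + (n - + 2) * b
  eq₁ n a b c = solve (n ∷ a ∷ b ∷ c ∷ [])
  eq₂ : ∀ n a b c → a + n * b + (c + 0ℤ) ≡ (a + b + c) + (n - 1ℤ) * b
  eq₂ n a b c = solve (n ∷ a ∷ b ∷ c ∷ [])
... | inj₂ v<0 = mid⁺⁻ {n} {v} {1ℤ} {a} {b} {c} n0 (0≤-pred 1 v<0) (go (minus-one-split v<0) (one-split n1))
  where
  n0 = 0≤-pred 1 n1
  eq₀ : ∀ v → -1ℤ ≡ (v + 1ℤ) + (- v - + 2)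
  eq₀ v = solve (v ∷ [])
  eq₁ : ∀ n a b c → - b + (a + n * b) ≡ (a + b + c) + (- c) + (n - + 2) * b
  eq₁ n a b c = solve (n ∷ a ∷ b ∷ c ∷ [])
  eq₂ : ∀ n a b c → a + n * b + (c + 1ℤ * b) ≡ (a + b + c) + n * b
  eq₂ n a b c = solve (n ∷ a ∷ b ∷ c ∷ [])
  eq₃ : ∀ b c → - (- b + (c + 1ℤ * b)) ≡ - c
  eq₃ b c = solve (b ∷ c ∷ [])
  eq₄ : ∀ a b c → - b + (a + 1ℤ * b) + (c + 1ℤ * b) ≡ a + b + c
  eq₄ a b c = solve (a ∷ b ∷ c ∷ [])
  go : v ≡ -1ℤ ⊎ 0≤ - v - + 2 → n ≡ 1ℤ ⊎ 0≤ n - + 2 →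
    Safe (seed n -1ℤ v (λ t → - b t) (λ t → a t + n * b t) (λ t → c t + (- v) * b t))
  go (inj₂ v2) _ = ⊥-elim (0≰-1 (by (v1 ⊕ v2) (eq₀ v)))
  go (inj₁ refl) (inj₂ n2) = base (between (pair n2 (λ t → 0≤-- (g t))
    (λ t → by (s t ⊕ k t ⊕ n2 ⊗ g t) (eq₁ n (a t) (b t) (c t)))) 0≤0 0≤1
    (λ t → by (s t ⊕ n0 ⊗ g t) (eq₂ n (a t) (b t) (c t))) (inj₁ refl))
  go (inj₁ refl) (inj₁ refl) = base (splitB′ refl refl refl (λ t → 0≤-- (g t))
    (λ t → by (k t) (eq₃ (b t) (c t))) (λ t → by (s t) (eq₄ (a t) (b t) (c t))))

-- The paths J → A → B leave n - v ≥ 2 arrows J → B and c_J becomes c_A + c_J: the split pair is now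
-- the genuine pair of J and B, with A trapped.
splitA-first : ∀ {n v a b c} → 0≤ n - 1ℤ → 0≤ n - v - + 2 →
  Nonneg (λ t → - (a t + c t)) → Nonneg (λ t → a t + b t + c t) → Nonneg a → Safe (mid (rot (rot (seed n v 1ℤ a b c))))
splitA-first {n} {v} {a} {b} {c} n1 nv k s g = mid⁺⁺ {1ℤ} {n} {v} {c} {a} {b} 0≤1 n0 (rotˢ (base (trapped
    (pair (by nv (eq₁ n v)) (λ t → by (k t) (eq₂ (a t) (c t))) (λ t → by (s t) (eq₃ (a t) (b t) (c t))))
    (λ t → 0≤-- (g t)) n0 n1)))
  where
  n0 = 0≤-pred 1 n1
  eq₁ : ∀ n v → 1ℤ * n - v - + 2 ≡ n - v - + 2
  eq₁ n v = solve (n ∷ v ∷ [])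
  eq₂ : ∀ a c → - (c + 1ℤ * a) ≡ - (a + c)
  eq₂ a c = solve (a ∷ c ∷ [])
  eq₃ : ∀ a b c → c + 1ℤ * a + (b + 0ℤ) ≡ a + b + c
  eq₃ a b c = solve (a ∷ b ∷ c ∷ [])

-- B and J exchange roles: the new vectors of A and B add up to the old c_A, as `splitA` demands.
split-one-mid : ∀ {u a b c} → 0≤ - u - 1ℤ → Nonneg (λ t → - a t) → Nonneg (λ t → a t + b t + c t) → Nonneg b →
  Safe (mid (seed 1ℤ -1ℤ u a b c))
split-one-mid {u} {a} {b} {c} u1 r s g = mid⁺⁻ {1ℤ} { -1ℤ} {u} {a} {b} {c} 0≤1 0≤1 (rotˢ (base (splitA u1 (by u1 (eq₁ u)) 0≤0 refl
    (λ t → 0≤-- (g t)) (λ t → by (r t) (eq₂ (a t) (b t))) (λ t → by (s t) (eq₃ (a t) (b t) (c t))))))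
  where
  eq₁ : ∀ u → - u - -1ℤ - + 2 ≡ - u - 1ℤ
  eq₁ u = solve (u ∷ [])
  eq₂ : ∀ a b → - (a + 1ℤ * b + (- b)) ≡ - a
  eq₂ a b = solve (a ∷ b ∷ [])
  eq₃ : ∀ a b c → a + 1ℤ * b + (c + 1ℤ * b) + (- b) ≡ a + b + c
  eq₃ a b c = solve (a ∷ b ∷ c ∷ [])

splitB-mid : ∀ {n u a b c} → 0≤ 1ℤ - n → 0≤ - u - 1ℤ → 0≤ n - u - + 2 →
  Nonneg (λ t → - a t) → Nonneg (λ t → - c t) → Nonneg (λ t → a t + b t + c t) → Nonneg b →
  Safe (mid (seed n -1ℤ u a b c))
splitB-mid {n} {u} {a} {b} {c} n1 u1 nu r k s g with tri-split n
... | inj₂ (inj₁ refl) = split-one-mid {u} {a} {b} {c} u1 r s g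
... | inj₂ (inj₂ n2) = ⊥-elim (0≰-1 (by (n1 ⊕ n2) (eq n)))
  where
  eq : ∀ n → -1ℤ ≡ (1ℤ - n) + (n - + 2)
  eq n = solve (n ∷ [])
-- J takes the role of B: its vector becomes c_B + c_J, and n - u ≥ 2 arrows A → J are left.
... | inj₁ n0 = mid⁻⁻ {n} { -1ℤ} {u} {a} {b} {c} n0 0≤1 (flipˢ (rotˢ (rotˢ (base (detached
    (pair (by nu (eq₁ n u)) (λ t → -+0 (r t)) (λ t → by (s t) (eq₂ (a t) (b t) (c t))))
    (0≤-- n0) refl (λ t → 0≤-- (g t)) (λ t → by (k t) (eq₃ (b t) (c t))))))))
  where
  eq₁ : ∀ n u → - (u + n * -1ℤ) - + 2 ≡ n - u - + 2
  eq₁ n u = solve (n ∷ u ∷ [])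
  eq₂ : ∀ a b c → a + 0ℤ + (c + 1ℤ * b) ≡ a + b + c
  eq₂ a b c = solve (a ∷ b ∷ c ∷ [])
  eq₃ : ∀ b c → - (c + 1ℤ * b + (- b)) ≡ - c
  eq₃ b c = solve (b ∷ c ∷ [])

-- The path A → J → B raises the simple arrow A → B to multiplicity 2, the least that a pair allows.
splitB′-last : ∀ {a b c} → Nonneg (λ t → - (a t + c t)) → Nonneg (λ t → a t + b t + c t) → Nonneg c →
  Safe (mid (rot (seed 1ℤ -1ℤ -1ℤ a b c)))
splitB′-last {a} {b} {c} k s g = mid⁻⁻ { -1ℤ} { -1ℤ} {1ℤ} {b} {c} {a} 0≤1 0≤1 (rotˢ (rotˢ (base (trapped
    (pair 0≤0 (λ t → by (k t) (eq₁ (a t) (c t))) (λ t → by (s t) (eq₂ (a t) (b t) (c t))))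
    (λ t → 0≤-- (g t)) 0≤1 0≤0))))
  where
  eq₁ : ∀ a c → - (a + 1ℤ * c) ≡ - (a + c)
  eq₁ a c = solve (a ∷ c ∷ [])
  eq₂ : ∀ a b c → a + 1ℤ * c + (b + 0ℤ) ≡ a + b + c
  eq₂ a b c = solve (a ∷ b ∷ c ∷ [])

-- Closure of the safe configurations under green mutation

state-step : ∀ {s} → State s → Independent s → Step s
state-step {s} (initial {n} {v} {u} {a} {b} {c} n2 v2 u2 a0 b0 c0) ind =
    (λ _ → step-initial {n} {v} {u} {a} {b} {c} n2 v2 u2 a0 b0 c0)
  , (λ _ → step-initial {v} {u} {n} {b} {c} {a} v2 u2 n2 b0 c0 a0)
  , (λ _ → step-initial {u} {n} {v} {c} {a} {b} u2 n2 v2 c0 a0 b0)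
state-step {s} (above {v = v} {u} {c = c} P u0 h) ind =
    (λ _ → above-mid {v = v} {u} {c = c} P u0 h)
  , (λ g → above-last {v = v} {u} {c = c} P u0 h g)
  , (λ g → ⊥-elim (c₁≢0 {s} ind g (Pair.red P)))
state-step {s} (between {n} {v} {u} {a} {b} {c} P u1 v0 h w) ind =
    (λ _ → between-mid {v = v} {u} {c = c} P u1 h)
  , last w
  , (λ g → ⊥-elim (c₁≢0 {s} ind g (Pair.red P)))
  where
  last : u ≡ -1ℤ ⊎ 0≤ - u - + 2 × (Nonneg (λ t → (- u - 1ℤ) * c t + a t) ⊎ Nonneg (λ t → - c t)) →
    Nonneg c → Safe (mid (rot s))
  last (inj₁ refl)          g = between-last-one {v = v} P v0 g
  last (inj₂ (u2 , inj₁ w)) g = between-last-two {v = v} {u} {c = c} P v0 u2 w g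
  last (inj₂ (u2 , inj₂ k)) g = ⊥-elim (c₃≢0 {s} ind g k)
state-step {s} (below {v = v} {u} {c = c} P u1 v1 c0 w) ind =
    (λ _ → swap-above {u = u} {c = c} P (0≤-pred 1 v1) (λ t → b≥0 P t ⊕ c0 t))
  , (λ g → below-last {v = v} {u} {c = c} P u1 v1 w g)
  , (λ g → ⊥-elim (c₁≢0 {s} ind g (Pair.red P)))
state-step {s} (trapped {v = v} {u} {c = c} P k v0 vu) ind =
    (λ _ → trapped-mid {v = v} {u} {c = c} P k v0 vu)
  , (λ g → ⊥-elim (c₃≢0 {s} ind g k))
  , (λ g → ⊥-elim (c₁≢0 {s} ind g (Pair.red P)))
state-step {s} (detached {u = u} {c = c} P u0 refl k l) ind =
    (λ _ → detached-mid {u = u} {c = c} P u0 l)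
  , (λ g → ⊥-elim (c₃≢0 {s} ind g k))
  , (λ g → ⊥-elim (c₁≢0 {s} ind g (Pair.red P)))
state-step {s} (splitA {n} {v} {a = a} {b} {c} n1 nv v1 refl k l sum) ind =
    (λ g → splitA-mid {n} {v} {a} {b} {c} n1 nv v1 k sum g)
  , (λ g → ⊥-elim (c₃≢0 {s} ind g k))
  , (λ g → splitA-first {n} {v} {a} {b} {c} n1 nv l sum g)
state-step {s} (splitB {n} {u = u} {a} {b} {c} n1 refl u1 nu r k sum) ind =
    (λ g → splitB-mid {n} {u} {a} {b} {c} n1 u1 nu r k sum g)
  , (λ g → ⊥-elim (c₃≢0 {s} ind g k))
  , (λ g → ⊥-elim (c₁≢0 {s} ind g r))
state-step {s} (splitB′ {a = a} {b} {c} refl refl refl r k sum) ind =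
    (λ g → split-one-mid { -1ℤ} {a} {b} {c} 0≤0 r sum g)
  , (λ g → splitB′-last {a} {b} {c} k sum g)
  , (λ g → ⊥-elim (c₁≢0 {s} ind g r))

unflip : ∀ s → Safe (mid (flip s)) → Safe (mid s)
unflip s h = flipˢ (subst Safe (mid-flip s) h)

safe-step : ∀ {s} → Safe s → Independent s → Step s
safe-step (base h) ind = state-step h ind
safe-step {s} (rotˢ h) ind with safe-step h (ind-rot {s} ind)
... | f , g , k = k , f , g
safe-step {s} (flipˢ h) ind with safe-step h (ind-flip {s} ind)
... | f , g , k = (λ x → unflip s (f x)) , (λ x → unflip (rot s) (k x)) , (λ x → unflip (rot (rot s)) (g x))

AllRed : Seed → Set
AllRed s = Nonneg (λ t → - c₁ s t) × Nonneg (λ t → - c₂ s t) × Nonneg (λ t → - c₃ s t)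

alive : ∀ {s} → Safe s → Independent s → ¬ AllRed s
alive {s} (rotˢ h)  ind (r₁ , r₂ , r₃) = alive h (ind-rot {s} ind) (r₂ , r₃ , r₁)
alive {s} (flipˢ h) ind (r₁ , r₂ , r₃) = alive h (ind-flip {s} ind) (r₃ , r₂ , r₁)
alive {s} (base (initial _ _ _ a0 _ _))        ind (r₁ , _ , _)   = c₁≢0 {s} ind a0 r₁
alive {s} (base (above P _ _))                 ind (r₁ , r₂ , _)  = c₁+c₂≢0 {s} ind (Pair.dom P) r₁ r₂
alive {s} (base (between P _ _ _ _))           ind (r₁ , r₂ , _)  = c₁+c₂≢0 {s} ind (Pair.dom P) r₁ r₂
alive {s} (base (below P _ _ _ _))             ind (r₁ , r₂ , _)  = c₁+c₂≢0 {s} ind (Pair.dom P) r₁ r₂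
alive {s} (base (trapped P _ _ _))             ind (r₁ , r₂ , _)  = c₁+c₂≢0 {s} ind (Pair.dom P) r₁ r₂
alive {s} (base (detached P _ _ _ _))          ind (r₁ , r₂ , _)  = c₁+c₂≢0 {s} ind (Pair.dom P) r₁ r₂
alive {s} (base (splitA _ _ _ _ _ _ sum))      ind (r₁ , r₂ , r₃) = c₁+c₂+c₃≢0 {s} ind sum r₁ r₂ r₃
alive {s} (base (splitB _ _ _ _ _ _ sum))      ind (r₁ , r₂ , r₃) = c₁+c₂+c₃≢0 {s} ind sum r₁ r₂ r₃
alive {s} (base (splitB′ _ _ _ _ _ sum))       ind (r₁ , r₂ , r₃) = c₁+c₂+c₃≢0 {s} ind sum r₁ r₂ r₃

-- From framed quivers to seeds

signed : ∀ {V : Set} → Arrows V → V → V → ℤ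
signed a i j = + a i j - + a j i

signed-swap : ∀ {V : Set} (a : Arrows V) i j → signed a j i ≡ - signed a i j
signed-swap a i j = eq (+ a i j) (+ a j i)
  where
  eq : ∀ x y → y - x ≡ - (x - y)
  eq x y = solve (x ∷ y ∷ [])

TwoAcyclic : ∀ {V : Set} → Arrows V → V → V → Set
TwoAcyclic a i j = a i j ≡ 0 ⊎ a j i ≡ 0

signed⁺ : ∀ {V : Set} (a : Arrows V) {i j} → TwoAcyclic a i j → signed a i j ⊔ 0ℤ ≡ + a i j
signed⁺ a {i} {j} (inj₁ e) rewrite e = ⁺-nonpos (by {+ a j i} (+≤+ z≤n) (eq (+ a j i)))
  where
  eq : ∀ x → - (0ℤ - x) ≡ x
  eq x = solve (x ∷ [])
signed⁺ a {i} {j} (inj₂ e) rewrite e = trans (⁺-nonneg (by {+ a i j} (+≤+ z≤n) (eq (+ a i j)))) (eq (+ a i j))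
  where
  eq : ∀ x → x - 0ℤ ≡ x
  eq x = solve (x ∷ [])

-- Truncated subtraction in both directions cancels 2-cycles, which the signed count does not see.
signed-∸ : ∀ x y → + (x ℕ.∸ y) - + (y ℕ.∸ x) ≡ + x - + y
signed-∸ ℕ.zero    ℕ.zero    = refl
signed-∸ ℕ.zero    (ℕ.suc y) = refl
signed-∸ (ℕ.suc x) ℕ.zero    = refl
signed-∸ (ℕ.suc x) (ℕ.suc y) = trans (signed-∸ x y)
  (trans (m-n≡m⊖n x y) (trans (sym ([1+m]⊖[1+n]≡m⊖n x y)) (sym (m-n≡m⊖n (ℕ.suc x) (ℕ.suc y)))))

module _ {V : Set} (_≟_ : DecidableEquality V) (k : V) (a : Arrows V) where

  mutate-from : ∀ j → mutate _≟_ k a k j ≡ a j k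
  mutate-from j with k ≟ k | j ≟ k
  ... | yes _ | _ = refl
  ... | no n  | _ = ⊥-elim (n refl)

  mutate-to : ∀ i → mutate _≟_ k a i k ≡ a k i
  mutate-to i with i ≟ k | k ≟ k
  ... | yes _ | _     = refl
  ... | no _  | yes _ = refl
  ... | no _  | no n  = ⊥-elim (n refl)

  mutate-off : ∀ {i j} → i ≢ k → j ≢ k →
    mutate _≟_ k a i j ≡ (a i j ℕ.+ a i k ℕ.* a k j) ℕ.∸ (a j i ℕ.+ a j k ℕ.* a k i)
  mutate-off {i} {j} i≢k j≢k with i ≟ k | j ≟ k
  ... | yes e | _     = ⊥-elim (i≢k e)
  ... | no _  | yes e = ⊥-elim (j≢k e)
  ... | no _  | no _  = refl

  signed-from : ∀ j → signed (mutate _≟_ k a) k j ≡ signed a j k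
  signed-from j = cong₂ (λ x y → + x - + y) (mutate-from j) (mutate-to j)

  signed-to : ∀ i → signed (mutate _≟_ k a) i k ≡ signed a k i
  signed-to i = cong₂ (λ x y → + x - + y) (mutate-to i) (mutate-from i)

  signed-off : ∀ {i j} → i ≢ k → j ≢ k →
    signed (mutate _≟_ k a) i j ≡ signed a i j + + a i k * + a k j - + a j k * + a k i
  signed-off {i} {j} i≢k j≢k
    rewrite mutate-off i≢k j≢k | mutate-off j≢k i≢k
    = trans (signed-∸ (a i j ℕ.+ a i k ℕ.* a k j) (a j i ℕ.+ a j k ℕ.* a k i))
      (trans (cong₂ _-_ (trans (pos-+ (a i j) _) (cong (_+_ (+ a i j)) (pos-* (a i k) (a k j))))
                        (trans (pos-+ (a j i) _) (cong (_+_ (+ a j i)) (pos-* (a j k) (a k i)))))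
             (eq (+ a i j) (+ a j i) (+ a i k * + a k j) (+ a j k * + a k i)))
    where
    eq : ∀ x y z w → x + z - (y + w) ≡ x - y + z - w
    eq x y z w = solve (x ∷ y ∷ z ∷ w ∷ [])

  mutate-loopless : ∀ {i} → a i i ≡ 0 → mutate _≟_ k a i i ≡ 0
  mutate-loopless {i} e with i ≟ k
  ... | yes _ = e
  ... | no _  = n∸n≡0 (a i i ℕ.+ a i k ℕ.* a k i)

  mutate-2acyclic : ∀ {i j} → TwoAcyclic a i j → TwoAcyclic (mutate _≟_ k a) i j
  mutate-2acyclic {i} {j} h with i ≟ k | j ≟ k
  ... | yes _ | yes _ = ⊎-swap h
  ... | yes _ | no _  = ⊎-swap h
  ... | no _  | yes _ = ⊎-swap h
  ... | no _  | no _ with ≤-totalℕ (a i j ℕ.+ a i k ℕ.* a k j) (a j i ℕ.+ a j k ℕ.* a k i)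
  ...   | inj₁ le = inj₁ (m≤n⇒m∸n≡0 le)
  ...   | inj₂ le = inj₂ (m≤n⇒m∸n≡0 le)

μ-quiver : ∀ {n} {a : Arrows (Fin n)} k → IsQuiver a → IsQuiver (μ k a)
μ-quiver {a = a} k (d , t) = (λ i → mutate-loopless _≟F_ k a (d i)) , (λ i j → mutate-2acyclic _≟F_ k a (t i j))

-- Triples of signed multiplicities and their mutation

record Triple : Set where
  constructor triple
  field
    p q r : ℤ

rotᵗ flipᵗ midᵗ : Triple → Triple
rotᵗ  (triple p q r) = triple q r p
flipᵗ (triple p q r) = triple (- q) (- p) (- r)
midᵗ  (triple p q r) = triple (- p) (- q) (r - (p ⊔ 0ℤ) * (q ⊔ 0ℤ) + (- p ⊔ 0ℤ) * (- q ⊔ 0ℤ))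

edges : ∀ {V : Set} → Arrows V → V → V → V → Triple
edges a i j k = triple (signed a i j) (signed a j k) (signed a k i)

triple-cong : ∀ {p p′ q q′ r r′} → p ≡ p′ → q ≡ q′ → r ≡ r′ → triple p q r ≡ triple p′ q′ r′
triple-cong refl refl refl = refl

-signed⁺ : ∀ {V : Set} (a : Arrows V) {i j} → TwoAcyclic a i j → - signed a i j ⊔ 0ℤ ≡ + a j i
-signed⁺ a {i} {j} h = trans (cong (_⊔ 0ℤ) (sym (signed-swap a i j))) (signed⁺ a (⊎-swap h))

edges-mid : ∀ {V : Set} (_≟_ : DecidableEquality V) (a : Arrows V) {i j k} → i ≢ j → k ≢ j →
  TwoAcyclic a i j → TwoAcyclic a j k → edges (mutate _≟_ j a) i j k ≡ midᵗ (edges a i j k)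
edges-mid _≟_ a {i} {j} {k} i≢j k≢j ij jk = triple-cong
  (trans (signed-to _≟_ j a i) (signed-swap a i j))
  (trans (signed-from _≟_ j a k) (signed-swap a j k))
  (trans (signed-off _≟_ j a k≢j i≢j) last)
  where
  eq : ∀ r x y z w → r + x * y - z * w ≡ r - z * w + y * x
  eq r x y z w = solve (r ∷ x ∷ y ∷ z ∷ w ∷ [])
  last : signed a k i + + a k j * + a j i - + a i j * + a j k ≡ Triple.r (midᵗ (edges a i j k))
  last rewrite signed⁺ a ij | signed⁺ a jk | -signed⁺ a ij | -signed⁺ a jk =
    eq (signed a k i) (+ a k j) (+ a j i) (+ a i j) (+ a j k)

coords : Arrows (FVert 3) → Fin 3 → Coords
coords f i t = signed f (inj₁ i) (inj₂ t)

record Tracks (f : Arrows (FVert 3)) (i j k : Fin 3) (s : Seed) : Set where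
  constructor tracks
  field
    acyclic₁₂ : TwoAcyclic f (inj₁ i) (inj₁ j)
    acyclic₂₃ : TwoAcyclic f (inj₁ j) (inj₁ k)
    acyclic₃₁ : TwoAcyclic f (inj₁ k) (inj₁ i)
    edges≡    : edges f (inj₁ i) (inj₁ j) (inj₁ k) ≡ triple (e₁₂ s) (e₂₃ s) (e₃₁ s)
    coords₁   : ∀ t → coords f i t ≡ c₁ s t
    coords₂   : ∀ t → coords f j t ≡ c₂ s t
    coords₃   : ∀ t → coords f k t ≡ c₃ s t

tracks-rot : ∀ {f i j k s} → Tracks f i j k s → Tracks f j k i (rot s)
tracks-rot (tracks x y z e u v w) = tracks y z x (cong rotᵗ e) v w u

green-coords : ∀ {f j} → Green f j → ∀ t → coords f j t ≡ + f (inj₁ j) (inj₂ t)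
green-coords {f} {j} g t rewrite g t = eq (+ f (inj₁ j) (inj₂ t))
  where
  eq : ∀ x → x - 0ℤ ≡ x
  eq x = solve (x ∷ [])

inj₁-≢ : ∀ {i j : Fin 3} → i ≢ j → _≢_ {A = FVert 3} (inj₁ i) (inj₁ j)
inj₁-≢ i≢j refl = i≢j refl

-- No frozen vertex has an arrow to a green j, so only the paths i → j → t′ contribute. This
-- justifies the c-vectors in `mid`.
coords-off : ∀ {f i j} → i ≢ j → Green f j → ∀ t →
  coords (fmut j f) i t ≡ coords f i t + + f (inj₁ i) (inj₁ j) * coords f j t
coords-off {f} {i} {j} i≢j g t = trans (signed-off (≡-dec _≟F_ _≟F_) (inj₁ j) f (inj₁-≢ i≢j) (λ ()))
  (trans (cong (λ z → coords f i t + + f (inj₁ i) (inj₁ j) * + f (inj₁ j) (inj₂ t) - + z * + f (inj₁ j) (inj₁ i)) (g t))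
  (trans (eq (coords f i t) (+ f (inj₁ i) (inj₁ j)) (+ f (inj₁ j) (inj₂ t)))
         (cong (λ z → coords f i t + + f (inj₁ i) (inj₁ j) * z) (sym (green-coords {f} g t)))))
  where
  eq : ∀ c x y → c + x * y - 0ℤ ≡ c + x * y
  eq c x y = solve (c ∷ x ∷ y ∷ [])

tracks-mid : ∀ {f i j k s} → i ≢ j → k ≢ j → Tracks f i j k s → Green f j → Tracks (fmut j f) i j k (mid s)
tracks-mid {f} {i} {j} {k} {s} i≢j k≢j (tracks x y z e u v w) g =
  tracks (acyc x) (acyc y) (acyc z)
    (trans (edges-mid _≟V_ f (inj₁-≢ i≢j) (inj₁-≢ k≢j) x y) (cong midᵗ e))
    (λ t → trans (coords-off i≢j g t)
      (cong₂ _+_ (u t) (cong₂ _*_ (trans (sym (signed⁺ f x)) (cong (λ z → Triple.p z ⊔ 0ℤ) e)) (v t))))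
    (λ t → trans (signed-from _≟V_ (inj₁ j) f (inj₂ t)) (trans (signed-swap f (inj₁ j) (inj₂ t)) (cong -_ (v t))))
    (λ t → trans (coords-off k≢j g t)
      (cong₂ _+_ (w t) (cong₂ _*_ (trans (sym (-signed⁺ f y)) (cong (λ z → - Triple.q z ⊔ 0ℤ) e)) (v t))))
  where
  _≟V_ = ≡-dec _≟F_ _≟F_
  acyc : ∀ {i′ j′} → TwoAcyclic f (inj₁ i′) (inj₁ j′) → TwoAcyclic (fmut j f) (inj₁ i′) (inj₁ j′)
  acyc = mutate-2acyclic _≟V_ (inj₁ j) f

green-nonneg : ∀ {f j} → Green f j → Nonneg (coords f j)
green-nonneg {f} {j} g t = subst 0≤_ (sym (green-coords {f} g t)) (+≤+ z≤n)

red-nonpos : ∀ {f j} → Red f j → Nonneg (λ t → - coords f j t)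
red-nonpos {f} {j} h t rewrite h t = by {+ f (inj₂ t) (inj₁ j)} (+≤+ z≤n) (eq (+ f (inj₂ t) (inj₁ j)))
  where
  eq : ∀ x → - (0ℤ - x) ≡ x
  eq x = solve (x ∷ [])

nonneg-resp : ∀ {c c′ : Coords} → (∀ t → c t ≡ c′ t) → Nonneg c → Nonneg c′
nonneg-resp e h t = subst 0≤_ (e t) (h t)

no-mgs-from : ∀ ks {f s} → Tracks f 0F 1F 2F s → Safe s → Independent s → ¬ IsMGSFrom f ks
no-mgs-from [] {f} {s} T h ind r = alive h ind
  ( (λ t → subst (λ z → 0≤ - z) (Tracks.coords₁ T t) (red-nonpos {f} (r 0F) t))
  , (λ t → subst (λ z → 0≤ - z) (Tracks.coords₂ T t) (red-nonpos {f} (r 1F) t))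
  , (λ t → subst (λ z → 0≤ - z) (Tracks.coords₃ T t) (red-nonpos {f} (r 2F) t)))
no-mgs-from (1F ∷ ks) {f} {s} T h ind (g , m) =
  no-mgs-from ks (tracks-mid (λ ()) (λ ()) T g)
    (proj₁ (safe-step h ind) (nonneg-resp (Tracks.coords₂ T) (green-nonneg {f} g))) (ind-mid {s} ind) m
no-mgs-from (2F ∷ ks) {f} {s} T h ind (g , m) =
  no-mgs-from ks (tracks-rot (tracks-rot (tracks-mid (λ ()) (λ ()) (tracks-rot T) g)))
    (rotˢ (proj₁ (proj₂ (safe-step h ind)) (nonneg-resp (Tracks.coords₃ T) (green-nonneg {f} g))))
    (ind-rot {rot s₁} (ind-rot {s₁} (ind-mid {rot s} (ind-rot {s} ind)))) m
  where s₁ = mid (rot s)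
no-mgs-from (0F ∷ ks) {f} {s} T h ind (g , m) =
  no-mgs-from ks (tracks-rot (tracks-mid (λ ()) (λ ()) (tracks-rot (tracks-rot T)) g))
    (rotˢ (rotˢ (proj₂ (proj₂ (safe-step h ind)) (nonneg-resp (Tracks.coords₁ T) (green-nonneg {f} g)))))
    (ind-rot {s₁} (ind-mid {rot (rot s)} (ind-rot {rot s} (ind-rot {s} ind)))) m
  where s₁ = mid (rot (rot s))

data Orb (P : Triple → Set) : Triple → Set where
  here  : ∀ {e} → P e → Orb P e
  rotᵒ  : ∀ {e} → Orb P (rotᵗ e) → Orb P e
  flipᵒ : ∀ {e} → Orb P (flipᵗ e) → Orb P e

data Abundant : Triple → Set where
  abundant : ∀ {x y z} → 0≤ x - + 2 → 0≤ y - + 2 → 0≤ z - + 2 → Abundant (triple x y z)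

withCoords : Triple → Coords → Coords → Coords → Seed
withCoords (triple p q r) = seed p q r

abundant⇒safe : ∀ {e a b c} → Orb Abundant e → Nonneg a → Nonneg b → Nonneg c → Safe (withCoords e a b c)
abundant⇒safe (here (abundant x y z)) a0 b0 c0 = base (initial x y z a0 b0 c0)
abundant⇒safe (rotᵒ h)  a0 b0 c0 = rotˢ (abundant⇒safe h b0 c0 a0)
abundant⇒safe (flipᵒ h) a0 b0 c0 = flipˢ (abundant⇒safe h c0 b0 a0)

sig : Arrows (Fin 3) → Triple
sig a = edges a 0F 1F 2F

framed-nonneg : ∀ a i → Nonneg (coords (framed a) i)
framed-nonneg a i t with i ≟F t
... | yes _ = +≤+ z≤n
... | no _  = +≤+ z≤n

abundant⇒¬mgs : ∀ {a} → IsQuiver a → Orb Abundant (sig a) → ¬ HasMGS a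
abundant⇒¬mgs {a} (_ , t) h (ks , m) = no-mgs-from ks
  (tracks (t _ _) (t _ _) (t _ _) refl (λ _ → refl) (λ _ → refl) (λ _ → refl))
  (abundant⇒safe h (framed-nonneg a 0F) (framed-nonneg a 1F) (framed-nonneg a 2F))
  ind m
  where
  ind : Independent (withCoords (sig a) (coords (framed a) 0F) (coords (framed a) 1F) (coords (framed a) 2F))
  -- The c-vectors of the framed quiver are the unit vectors, so each coordinate of the relation is
  -- one coefficient.
  ind α β γ h = trans (eq₁ α β γ) (h 0F) , trans (eq₂ α β γ) (h 1F) , trans (eq₃ α β γ) (h 2F)
    where
    eq₁ : ∀ α β γ → α ≡ α * 1ℤ + β * 0ℤ + γ * 0ℤ
    eq₁ α β γ = solve (α ∷ β ∷ γ ∷ [])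
    eq₂ : ∀ α β γ → β ≡ α * 0ℤ + β * 1ℤ + γ * 0ℤ
    eq₂ α β γ = solve (α ∷ β ∷ γ ∷ [])
    eq₃ : ∀ α β γ → γ ≡ α * 0ℤ + β * 0ℤ + γ * 1ℤ
    eq₃ α β γ = solve (α ∷ β ∷ γ ∷ [])

-- Mutation classes of triples

edgesOf : Seed → Triple
edgesOf (seed p q r _ _ _) = triple p q r

midᵗ-flip : ∀ e → midᵗ (flipᵗ e) ≡ flipᵗ (midᵗ e)
midᵗ-flip (triple p q r) = cong edgesOf (mid-flip (seed p q r (λ _ → 0ℤ) (λ _ → 0ℤ) (λ _ → 0ℤ)))

-- The multiplicities after `mid` do not involve the c-vectors, so the rules for seeds apply with
-- dummy vectors `o`.
module TripleMoves (Q : Triple → Set)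
  (rotQ : ∀ {e} → Q (rotᵗ e) → Q e) (flipQ : ∀ {e} → Q (flipᵗ e) → Q e) where

  private
    module M = Moves (λ s → Q (edgesOf s)) (λ {s} → rotQ {edgesOf s}) (λ {s} → flipQ {edgesOf s})
    o : Coords
    o _ = 0ℤ

  midᵗ⁺⁺ : ∀ {p q r} → 0≤ p → 0≤ q → Q (triple p (p * q - r) q) → Q (midᵗ (triple p q r))
  midᵗ⁺⁺ {p} {q} {r} = M.mid⁺⁺ {p} {q} {r} {o} {o} {o}

  midᵗ⁺⁻ : ∀ {p q r} → 0≤ p → 0≤ - q → Q (triple p (- r) q) → Q (midᵗ (triple p q r))
  midᵗ⁺⁻ {p} {q} {r} = M.mid⁺⁻ {p} {q} {r} {o} {o} {o}

  midᵗ⁻⁺ : ∀ {p q r} → 0≤ - p → 0≤ q → Q (triple (- p) (- q) r) → Q (midᵗ (triple p q r))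
  midᵗ⁻⁺ {p} {q} {r} = M.mid⁻⁺ {p} {q} {r} {o} {o} {o}

Steps : (Triple → Set) → Triple → Set
Steps Q e = Q (midᵗ e) × Q (midᵗ (rotᵗ e)) × Q (midᵗ (rotᵗ (rotᵗ e)))

-- In `grow` the mutation at the vertex opposite to the largest multiplicity z leads back into the
-- tree; at a `fork` no mutation decreases a multiplicity.
data Tree (L : List Triple) : Triple → Set where
  root  : ∀ {e} → e ∈ L → Tree L e
  fork  : ∀ {x y z} → 0≤ x - + 2 → 0≤ y - + 2 → 0≤ z - + 2 →
    0≤ y * z - x - x → 0≤ z * x - y - y → 0≤ x * y - z - z → Tree L (triple x y z)
  grow  : ∀ {x y z} → 0≤ x - + 2 → 0≤ y - + 2 → 0≤ z - x → 0≤ z - y →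
    Tree L (midᵗ (triple x y z)) → Tree L (triple x y z)
  rotᵀ  : ∀ {e} → Tree L (rotᵗ e) → Tree L e
  flipᵀ : ∀ {e} → Tree L (flipᵗ e) → Tree L e

zero-split : ∀ {x} → 0≤ x → x ≡ 0ℤ ⊎ 0≤ x - 1ℤ
zero-split {+ 0}       _ = inj₁ refl
zero-split {+ ℕ.suc n} _ = inj₂ (+≤+ z≤n)

halve : ∀ {x} → 0≤ x + x → 0≤ x
halve {+ n} _ = +≤+ z≤n
halve { -[1+ n ]} ()

module _ {L : List Triple} where

  open TripleMoves (Tree L) rotᵀ flipᵀ

  -- The new multiplicity p q - r is a largest one, and mutating once more at the same vertex gives
  -- back r; this is the subtree that `grow` requires.
  up : ∀ {p q r} → 0≤ p - + 2 → 0≤ q - + 2 → 0≤ p * q - r - p → 0≤ p * q - r - q →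
    Tree L (triple p q r) → Tree L (midᵗ (triple p q r))
  up {p} {q} {r} p2 q2 h k T = midᵗ⁺⁺ {p} {q} {r} p0 q0 (rotᵀ (rotᵀ (grow {x = q} {p} {p * q - r} q2 p2 k h (midᵗ⁺⁺ {q} {p} {p * q - r} q0 p0
      (subst (λ z → Tree L (triple q z p)) (eq p q r) (rotᵀ (rotᵀ T)))))))
    where
    p0 = 0≤-pred {p} 2 p2
    q0 = 0≤-pred {q} 2 q2
    eq : ∀ p q r → r ≡ q * p - (p * q - r)
    eq p q r = solve (p ∷ q ∷ r ∷ [])

  -- From 2 z ≤ x y follows 2 (x y - z) ≥ x y, which is at least 2 x and 2 y. The certificates are
  -- doubled to avoid division.
  fork-mid : ∀ {x y z} → 0≤ x - + 2 → 0≤ y - + 2 → 0≤ z - + 2 →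
    0≤ y * z - x - x → 0≤ z * x - y - y → 0≤ x * y - z - z → Tree L (midᵗ (triple x y z))
  fork-mid {x} {y} {z} x2 y2 z2 hx hy hz = up {x} {y} {z} x2 y2
      (halve (by (hz ⊕ 0≤-pred {x} 2 x2 ⊗ y2) (eq₁ x y z)))
      (halve (by (hz ⊕ x2 ⊗ 0≤-pred {y} 2 y2) (eq₂ x y z))) (fork {x = x} {y} {z} x2 y2 z2 hx hy hz)
    where
    eq₁ : ∀ x y z → (x * y - z - x) + (x * y - z - x) ≡ (x * y - z - z) + x * (y - + 2)
    eq₁ x y z = solve (x ∷ y ∷ z ∷ [])
    eq₂ : ∀ x y z → (x * y - z - y) + (x * y - z - y) ≡ (x * y - z - z) + (x - + 2) * y
    eq₂ x y z = solve (x ∷ y ∷ z ∷ [])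

  grow-steps : ∀ {x y z} → 0≤ x - + 2 → 0≤ y - + 2 → 0≤ z - x → 0≤ z - y →
    Tree L (midᵗ (triple x y z)) → Steps (Tree L) (triple x y z)
  grow-steps {x} {y} {z} x2 y2 zx zy T = T
    , up {y} {z} {x} y2 z2 (by (zx ⊕ (y2 ⊕ t ⊕ y2 ⊗ t)) (eq₁ x y z)) (by (zx ⊕ y2 ⊗ 0≤-pred {z} 2 z2) (eq₂ x y z)) (rotᵀ (rotᵀ G))
    , up {z} {x} {y} z2 x2 (by (zy ⊕ 0≤-pred {z} 2 z2 ⊗ x2) (eq₃ x y z)) (by (zy ⊕ (x2 ⊕ t ⊕ x2 ⊗ t)) (eq₄ x y z)) (rotᵀ G)
    where
    G = grow {x = x} {y} {z} x2 y2 zx zy T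
    eq₀ : ∀ x z → z - + 2 ≡ (z - x) + (x - + 2)
    eq₀ x z = solve (x ∷ z ∷ [])
    t : 0≤ z - + 2
    t = by (zx ⊕ x2) (eq₀ x z)
    z2 = t
    eq₁ : ∀ x y z → y * z - x - y ≡ (z - x) + ((y - + 2) + (z - + 2) + (y - + 2) * (z - + 2))
    eq₁ x y z = solve (x ∷ y ∷ z ∷ [])
    eq₂ : ∀ x y z → y * z - x - z ≡ (z - x) + (y - + 2) * z
    eq₂ x y z = solve (x ∷ y ∷ z ∷ [])
    eq₃ : ∀ x y z → z * x - y - z ≡ (z - y) + z * (x - + 2)
    eq₃ x y z = solve (x ∷ y ∷ z ∷ [])
    eq₄ : ∀ x y z → z * x - y - x ≡ (z - y) + ((x - + 2) + (z - + 2) + (x - + 2) * (z - + 2))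
    eq₄ x y z = solve (x ∷ y ∷ z ∷ [])

  unflipᵀ : ∀ e → Tree L (midᵗ (flipᵗ e)) → Tree L (midᵗ e)
  unflipᵀ e h = flipᵀ (subst (Tree L) (midᵗ-flip e) h)

  tree-steps : (∀ {e} → e ∈ L → Steps (Tree L) e) → ∀ {e} → Tree L e → Steps (Tree L) e
  tree-steps close (root m) = close m
  tree-steps close (fork {x} {y} {z} x2 y2 z2 hx hy hz) =
    fork-mid {x} {y} {z} x2 y2 z2 hx hy hz , fork-mid {y} {z} {x} y2 z2 x2 hy hz hx , fork-mid {z} {x} {y} z2 x2 y2 hz hx hy
  tree-steps close (grow {x} {y} {z} x2 y2 zx zy T) = grow-steps {x} {y} {z} x2 y2 zx zy T
  tree-steps close (rotᵀ T) with tree-steps close T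
  ... | f , g , k = k , f , g
  tree-steps close {e} (flipᵀ T) with tree-steps close T
  ... | f , g , k = unflipᵀ e f , unflipᵀ (rotᵗ e) k , unflipᵀ (rotᵗ (rotᵗ e)) g

  -- The middle vertex yields the cyclic quiver with r + p q; the sink and the source only reverse
  -- arrows and rotate the three multiplicities.
  acyclic-steps : ∀ {p q r} → 0≤ p → 0≤ q → 0≤ r →
    Tree L (triple q p (r + p * q)) → Tree L (triple q r (- p)) → Tree L (triple r p (- q)) →
    Steps (Tree L) (triple p q (- r))
  acyclic-steps {p} {q} {r} p0 q0 r0 M T₁ T₂ =
      midᵗ⁺⁺ {p} {q} { - r} p0 q0 (rotᵀ (rotᵀ (subst (λ z → Tree L (triple q p z)) (eq p q r) M)))
    , midᵗ⁺⁻ {q} { - r} {p} q0 (0≤-- r0) (flipᵀ (rotᵀ (rotᵀ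
        (subst (Tree L) (triple-cong (sym (neg-involutive r)) (sym (neg-involutive p)) refl) T₂))))
    , midᵗ⁻⁺ { - r} {p} {q} (0≤-- r0) p0 (rotᵀ (rotᵀ (subst (Tree L) (triple-cong refl (sym (neg-involutive r)) refl) T₁)))
    where
    eq : ∀ p q r → r + p * q ≡ p * q - (- r)
    eq p q r = solve (p ∷ q ∷ r ∷ [])

  -- Opposite to r + p q lies the acyclic quiver. Of the other two mutations, the one replacing q by
  -- p (r + p q) - q grows if p ≥ 2; if p = 1 it replaces q by r and lands at another cyclic quiver
  -- of the list. The third is symmetric in p and q.
  cyclic-steps : ∀ {p q r} → 0≤ p - 1ℤ → 0≤ q - 1ℤ → 0≤ r →
    Tree L (triple p q (- r)) → Tree L (triple p r (q + r * p)) → Tree L (triple r q (p + q * r)) →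
    Tree L (triple q p (r + p * q)) → Steps (Tree L) (triple q p (r + p * q))
  cyclic-steps {p} {q} {r} p1 q1 r0 T M₁ M₂ M =
      midᵗ⁺⁺ {q} {p} {r + p * q} q0 p0 (rotᵀ (rotᵀ (subst (λ z → Tree L (triple p q z)) (eq₁ p q r) T)))
    , left (one-split p1) , right (one-split q1)
    where
    p0 = 0≤-pred {p} 1 p1
    q0 = 0≤-pred {q} 1 q1
    w0 : 0≤ r + p * q
    w0 = r0 ⊕ p0 ⊗ q0
    eq₁ : ∀ p q r → - r ≡ q * p - (r + p * q)
    eq₁ p q r = solve (p ∷ q ∷ r ∷ [])
    eq₂ : ∀ q r → r ≡ 1ℤ * (r + 1ℤ * q) - q
    eq₂ q r = solve (q ∷ r ∷ [])
    eq₃ : ∀ q r → q + r * 1ℤ ≡ r + 1ℤ * q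
    eq₃ q r = solve (q ∷ r ∷ [])
    eq₄ : ∀ p q r → r + p * q - + 2 ≡ r + (p - + 2) * q + ((q - 1ℤ) + (q - 1ℤ))
    eq₄ p q r = solve (p ∷ q ∷ r ∷ [])
    eq₅ : ∀ p q r → p * (r + p * q) - q - p ≡
      p * r + (q - 1ℤ) * (p * p - 1ℤ) + ((p - + 2) * p + (p - 1ℤ))
    eq₅ p q r = solve (p ∷ q ∷ r ∷ [])
    eq₆ : ∀ p q r → p * (r + p * q) - q - (r + p * q) ≡ (p - 1ℤ) * r + q * ((p - + 2) * p + (p - 1ℤ))
    eq₆ p q r = solve (p ∷ q ∷ r ∷ [])
    eq₇ : ∀ p → p * p - 1ℤ ≡ (p - 1ℤ) * (p + 1ℤ)
    eq₇ p = solve (p ∷ [])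
    left : p ≡ 1ℤ ⊎ 0≤ p - + 2 → Tree L (midᵗ (triple p (r + p * q) q))
    left (inj₁ refl) = midᵗ⁺⁺ {1ℤ} {r + 1ℤ * q} {q} 0≤1 w0 (subst (Tree L) (triple-cong refl (eq₂ q r) (eq₃ q r)) M₁)
    left (inj₂ p2) = up {p} {r + p * q} {q} p2 (by (r0 ⊕ p2 ⊗ q0 ⊕ (q1 ⊕ q1)) (eq₄ p q r))
      (by (p0 ⊗ r0 ⊕ q1 ⊗ by (p1 ⊗ (p0 ⊕ 0≤1)) (eq₇ p) ⊕ (p2 ⊗ p0 ⊕ p1)) (eq₅ p q r))
      (by (p1 ⊗ r0 ⊕ q0 ⊗ (p2 ⊗ p0 ⊕ p1)) (eq₆ p q r)) (rotᵀ (rotᵀ M))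
    eq₈ : ∀ p r → r ≡ (r + p * 1ℤ) * 1ℤ - p
    eq₈ p r = solve (p ∷ r ∷ [])
    eq₉ : ∀ p r → p + 1ℤ * r ≡ r + p * 1ℤ
    eq₉ p r = solve (p ∷ r ∷ [])
    eq₁₀ : ∀ p q r → r + p * q - + 2 ≡ r + p * (q - + 2) + ((p - 1ℤ) + (p - 1ℤ))
    eq₁₀ p q r = solve (p ∷ q ∷ r ∷ [])
    eq₁₁ : ∀ p q r → (r + p * q) * q - p - q ≡
      r * q + (p - 1ℤ) * (q * q - 1ℤ) + ((q - + 2) * q + (q - 1ℤ))
    eq₁₁ p q r = solve (p ∷ q ∷ r ∷ [])
    eq₁₂ : ∀ p q r → (r + p * q) * q - p - (r + p * q) ≡ r * (q - 1ℤ) + p * ((q - + 2) * q + (q - 1ℤ))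
    eq₁₂ p q r = solve (p ∷ q ∷ r ∷ [])
    right : q ≡ 1ℤ ⊎ 0≤ q - + 2 → Tree L (midᵗ (triple (r + p * q) q p))
    right (inj₁ refl) = midᵗ⁺⁺ {r + p * 1ℤ} {1ℤ} {p} w0 0≤1 (rotᵀ (subst (Tree L) (triple-cong (eq₈ p r) refl (eq₉ p r)) M₂))
    right (inj₂ q2) = up {r + p * q} {q} {p} (by (r0 ⊕ p0 ⊗ q2 ⊕ (p1 ⊕ p1)) (eq₁₀ p q r)) q2
      (by (r0 ⊗ q1 ⊕ p0 ⊗ (q2 ⊗ q0 ⊕ q1)) (eq₁₂ p q r))
      (by (r0 ⊗ q0 ⊕ p1 ⊗ by (q1 ⊗ (q0 ⊕ 0≤1)) (eq₇ q) ⊕ (q2 ⊗ q0 ⊕ q1)) (eq₁₁ p q r)) (rotᵀ M)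

-- A certificate for a whole mutation class: `Tree L` is closed under mutation by `tree-steps`, and
-- by `tree-shape` its members are abundant or relabellings of members of `L`.
Good : Triple → Set
Good e = Σ (List Triple) λ L → length L ≤ 6 × (∀ {e} → e ∈ L → Steps (Tree L) e) × Tree L e

good-map : ∀ {e e′} → (∀ {L} → Tree L e → Tree L e′) → Good e → Good e′
good-map f (L , l , c , T) = L , l , c , f T

-- Classes of acyclic quivers

module _ (p q r : ℤ) (p1 : 0≤ p - 1ℤ) (q1 : 0≤ q - 1ℤ) (r1 : 0≤ r - 1ℤ) where

  private
    p0 = 0≤-pred {p} 1 p1
    q0 = 0≤-pred {q} 1 q1
    r0 = 0≤-pred {r} 1 r1

  triangle : List Triple
  triangle = triple p q (- r) ∷ triple q r (- p) ∷ triple r p (- q) ∷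
    triple q p (r + p * q) ∷ triple r q (p + q * r) ∷ triple p r (q + r * p) ∷ []

  private
    T₀ T₁ T₂ M₀ M₁ M₂ : Triple
    T₀ = triple p q (- r)
    T₁ = triple q r (- p)
    T₂ = triple r p (- q)
    M₀ = triple q p (r + p * q)
    M₁ = triple r q (p + q * r)
    M₂ = triple p r (q + r * p)
    t₀ : Tree triangle T₀
    t₀ = root (here refl)
    t₁ : Tree triangle T₁
    t₁ = root (there (here refl))
    t₂ : Tree triangle T₂
    t₂ = root (there (there (here refl)))
    m₀ : Tree triangle M₀
    m₀ = root (there (there (there (here refl))))
    m₁ : Tree triangle M₁
    m₁ = root (there (there (there (there (here refl)))))
    m₂ : Tree triangle M₂
    m₂ = root (there (there (there (there (there (here refl))))))

  triangle-closed : ∀ {e} → e ∈ triangle → Steps (Tree triangle) e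
  triangle-closed (here refl)                                         = acyclic-steps {p = p} {q} {r} p0 q0 r0 m₀ t₁ t₂
  triangle-closed (there (here refl))                                 = acyclic-steps {p = q} {r} {p} q0 r0 p0 m₁ t₂ t₀
  triangle-closed (there (there (here refl)))                         = acyclic-steps {p = r} {p} {q} r0 p0 q0 m₂ t₀ t₁
  triangle-closed (there (there (there (here refl))))                 = cyclic-steps {p = p} {q} {r} p1 q1 r0 t₀ m₂ m₁ m₀
  triangle-closed (there (there (there (there (here refl)))))         = cyclic-steps {p = q} {r} {p} q1 r1 p0 t₁ m₀ m₂ m₁
  triangle-closed (there (there (there (there (there (here refl)))))) = cyclic-steps {p = r} {p} {q} r1 p1 q0 t₂ m₁ m₀ m₂

  triangle-acyclic : Good T₀
  triangle-acyclic = triangle , ≤-reflℕ , triangle-closed , t₀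

  triangle-cyclic : Good M₀
  triangle-cyclic = triangle , ≤-reflℕ , triangle-closed , m₀

module _ (p q : ℤ) (p1 : 0≤ p - 1ℤ) (q1 : 0≤ q - 1ℤ) where

  private
    p0 = 0≤-pred {p} 1 p1
    q0 = 0≤-pred {q} 1 q1

  -- The linear orientation occurs with p before q and with q before p; the next two have a source
  -- or a sink in the centre. The summand `0ℤ` keeps the form `r + p * q` used in `cyclic-steps`.
  path : List Triple
  path = triple p q 0ℤ ∷ triple q p 0ℤ ∷ triple q 0ℤ (- p) ∷ triple 0ℤ p (- q) ∷
    triple q p (0ℤ + p * q) ∷ triple p q (0ℤ + q * p) ∷ []

  private
    tA : Tree path (triple p q 0ℤ)
    tA = root (here refl)
    tB : Tree path (triple q p 0ℤ)
    tB = root (there (here refl))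
    tC : Tree path (triple q 0ℤ (- p))
    tC = root (there (there (here refl)))
    tD : Tree path (triple 0ℤ p (- q))
    tD = root (there (there (there (here refl))))
    mA : Tree path (triple q p (0ℤ + p * q))
    mA = root (there (there (there (there (here refl)))))
    mB : Tree path (triple p q (0ℤ + q * p))
    mB = root (there (there (there (there (there (here refl))))))
    tC′ : Tree path (triple p 0ℤ (- q))
    tC′ = flipᵀ (rotᵀ (rotᵀ (subst (λ z → Tree path (triple z 0ℤ (- p))) (sym (neg-involutive q)) tC)))
    tD′ : Tree path (triple 0ℤ q (- p))
    tD′ = flipᵀ (rotᵀ (subst (λ z → Tree path (triple 0ℤ z (- q))) (sym (neg-involutive p)) tD))
    +*0 : ∀ x y → x ≡ x + y * 0ℤ
    +*0 x y = solve (x ∷ y ∷ [])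
    +0* : ∀ x y → x ≡ x + 0ℤ * y
    +0* x y = solve (x ∷ y ∷ [])
    x₁ : Tree path (triple 0ℤ q (p + q * 0ℤ))
    x₁ = rotᵀ (subst (λ z → Tree path (triple q z 0ℤ)) (+*0 p q) tB)
    x₂ : Tree path (triple p 0ℤ (q + 0ℤ * p))
    x₂ = rotᵀ (rotᵀ (subst (λ z → Tree path (triple z p 0ℤ)) (+0* q p) tB))
    x₃ : Tree path (triple 0ℤ p (q + p * 0ℤ))
    x₃ = rotᵀ (subst (λ z → Tree path (triple p z 0ℤ)) (+*0 q p) tA)
    x₄ : Tree path (triple q 0ℤ (p + 0ℤ * q))
    x₄ = rotᵀ (rotᵀ (subst (λ z → Tree path (triple z q 0ℤ)) (+0* p q) tA))

  path-closed : ∀ {e} → e ∈ path → Steps (Tree path) e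
  path-closed (here refl)                                         = acyclic-steps {p = p} {q} {0ℤ} p0 q0 0≤0 mA tC tD
  path-closed (there (here refl))                                 = acyclic-steps {p = q} {p} {0ℤ} q0 p0 0≤0 mB tC′ tD′
  path-closed (there (there (here refl)))                         = acyclic-steps {p = q} {0ℤ} {p} q0 0≤0 p0 x₁ tD tA
  path-closed (there (there (there (here refl))))                 = acyclic-steps {p = 0ℤ} {p} {q} 0≤0 p0 q0 x₂ tA tC
  path-closed (there (there (there (there (here refl)))))         = cyclic-steps {p = p} {q} {0ℤ} p1 q1 0≤0 tA x₂ x₁ mA
  path-closed (there (there (there (there (there (here refl)))))) = cyclic-steps {p = q} {p} {0ℤ} q1 p1 0≤0 tB x₄ x₃ mB

  path-good : ∀ {e} → Tree path e → Good e
  path-good T = path , ≤-reflℕ , path-closed , T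

  path-linear : Good (triple p q 0ℤ)
  path-linear = path-good tA
  path-source : Good (triple q 0ℤ (- p))
  path-source = path-good tC
  path-sink : Good (triple 0ℤ p (- q))
  path-sink = path-good tD
  path-cyclic : Good (triple q p (0ℤ + p * q))
  path-cyclic = path-good mA

edge-good : ∀ {p} → 0≤ p → Good (triple p 0ℤ 0ℤ)
edge-good {p} p0 = L , s≤s z≤n , closed , E
  where
  L = triple p 0ℤ 0ℤ ∷ []
  E : Tree L (triple p 0ℤ 0ℤ)
  E = root (here refl)
  eq : ∀ p → 0ℤ ≡ 0ℤ + p * 0ℤ
  eq p = solve (p ∷ [])
  closed : ∀ {e} → e ∈ L → Steps (Tree L) e
  closed (here refl) = acyclic-steps {p = p} {0ℤ} {0ℤ} p0 0≤0 0≤0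
    (rotᵀ (subst (λ z → Tree L (triple p z 0ℤ)) (eq p) E))
    (flipᵀ (rotᵀ (rotᵀ (subst (λ z → Tree L (triple z 0ℤ 0ℤ)) (sym (neg-involutive p)) E))))
    (rotᵀ E)

good-acyclic : ∀ {p q r} → 0≤ p → 0≤ q → 0≤ r → Good (triple p q (- r))
good-acyclic {p} {q} {r} p0 q0 r0 with zero-split p0 | zero-split q0 | zero-split r0
... | inj₂ p1   | inj₂ q1   | inj₂ r1   = triangle-acyclic p q r p1 q1 r1
... | inj₂ p1   | inj₂ q1   | inj₁ refl = path-linear p q p1 q1
... | inj₂ p1   | inj₁ refl | inj₂ r1   = path-source r p r1 p1
... | inj₁ refl | inj₂ q1   | inj₂ r1   = path-sink q r q1 r1
... | _         | inj₁ refl | inj₁ refl = edge-good p0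
... | inj₁ refl | _         | inj₁ refl = good-map rotᵀ (edge-good q0)
... | inj₁ refl | inj₁ refl | _         = good-map (λ {L} T → flipᵀ (rotᵀ (rotᵀ
        (subst (λ z → Tree L (triple z 0ℤ 0ℤ)) (sym (neg-involutive r)) T)))) (edge-good r0)

good-cyclic-root : ∀ {p q r} → 0≤ p - 1ℤ → 0≤ q - 1ℤ → 0≤ r → Good (triple q p (r + p * q))
good-cyclic-root {p} {q} {r} p1 q1 r0 with zero-split r0
... | inj₁ refl = path-cyclic p q p1 q1
... | inj₂ r1   = triangle-cyclic p q r p1 q1 r1

-- Descent from cyclic triples

mutual

  -- The fuel `n` bounds the sum of the multiplicities. Here a largest one is rotated into the last
  -- place; `descend` then decreases the sum.
  good-cyclic : ∀ n {x y z} → 0≤ + n - (x + y + z) → 0≤ x - 1ℤ → 0≤ y - 1ℤ → 0≤ z - 1ℤ → Good (triple x y z)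
  good-cyclic n {x} {y} {z} f x1 y1 z1 with sign-split (x - y)
  good-cyclic n {x} {y} {z} f x1 y1 z1 | inj₁ yx with sign-split (z - x)
  ... | inj₁ xz = descend n {x} {y} {z} f x1 y1 z1 xz (by (xz ⊕ yx) (eq x y z))
    where
    eq : ∀ x y z → z - y ≡ (z - x) + (x - y)
    eq x y z = solve (x ∷ y ∷ z ∷ [])
  ... | inj₂ zx = good-map rotᵀ (descend n {y} {z} {x} (by f (eq₁ (+ n) x y z)) y1 z1 x1 yx (by (zx ⊕ 0≤1) (eq₂ x z)))
    where
    eq₁ : ∀ n x y z → n - (y + z + x) ≡ n - (x + y + z)
    eq₁ n x y z = solve (n ∷ x ∷ y ∷ z ∷ [])
    eq₂ : ∀ x z → x - z ≡ - (z - x) - 1ℤ + 1ℤ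
    eq₂ x z = solve (x ∷ z ∷ [])
  good-cyclic n {x} {y} {z} f x1 y1 z1 | inj₂ xy with sign-split (z - y)
  ... | inj₁ yz = descend n {x} {y} {z} f x1 y1 z1 (by (yz ⊕ xy ⊕ 0≤1) (eq x y z)) yz
    where
    eq : ∀ x y z → z - x ≡ (z - y) + (- (x - y) - 1ℤ) + 1ℤ
    eq x y z = solve (x ∷ y ∷ z ∷ [])
  ... | inj₂ zy = good-map (λ T → rotᵀ (rotᵀ T)) (descend n {z} {x} {y} (by f (eq₁ (+ n) x y z)) z1 x1 y1
      (by (zy ⊕ 0≤1) (eq₂ y z)) (by (xy ⊕ 0≤1) (eq₂ y x)))
    where
    eq₁ : ∀ n x y z → n - (z + x + y) ≡ n - (x + y + z)
    eq₁ n x y z = solve (n ∷ x ∷ y ∷ z ∷ [])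
    eq₂ : ∀ y z → y - z ≡ - (z - y) - 1ℤ + 1ℤ
    eq₂ y z = solve (y ∷ z ∷ [])

  descend : ∀ n {x y z} → 0≤ + n - (x + y + z) → 0≤ x - 1ℤ → 0≤ y - 1ℤ → 0≤ z - 1ℤ →
    0≤ z - x → 0≤ z - y → Good (triple x y z)
  descend ℕ.zero {x} {y} {z} f x1 y1 z1 _ _ = ⊥-elim (0≰-1 (by (f ⊕ x1 ⊕ y1 ⊕ z1 ⊕ 0≤1 ⊕ 0≤1) (eq x y z)))
    where
    eq : ∀ x y z → -1ℤ ≡ 0ℤ - (x + y + z) + (x - 1ℤ) + (y - 1ℤ) + (z - 1ℤ) + 1ℤ + 1ℤ
    eq x y z = solve (x ∷ y ∷ z ∷ [])
  descend (ℕ.suc n) {x} {y} {z} f x1 y1 z1 zx zy with sign-split (z - x * y)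
  -- For z ≥ x y the mutation opposite to z is acyclic, with r = z - x y.
  ... | inj₁ r0 = subst (λ w → Good (triple x y w)) (eq x y z) (good-cyclic-root {y} {x} {z - x * y} y1 x1 r0)
    where
    eq : ∀ x y z → z - x * y + y * x ≡ z
    eq x y z = solve (x ∷ y ∷ z ∷ [])
  ... | inj₂ d1 with one-split {x} x1 | one-split {y} y1
  -- Now z < x y, so x = 1 would give z < y and y = 1 would give z < x, against the maximality of z.
  ...   | inj₁ refl | _ = ⊥-elim (0≰-1 (by (d1 ⊕ zy) (eq y z)))
    where
    eq : ∀ y z → -1ℤ ≡ - (z - 1ℤ * y) - 1ℤ + (z - y)
    eq y z = solve (y ∷ z ∷ [])
  ...   | inj₂ _ | inj₁ refl = ⊥-elim (0≰-1 (by (d1 ⊕ zx) (eq x z)))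
    where
    eq : ∀ x z → -1ℤ ≡ - (z - x * 1ℤ) - 1ℤ + (z - x)
    eq x z = solve (x ∷ z ∷ [])
  ...   | inj₂ x2 | inj₂ y2 with sign-split (x * y - z - z)
  -- As z is largest, the other two inequalities of `fork` are automatic. The class has no
  -- exceptional members, hence the empty list.
  ...     | inj₁ hz = [] , z≤n , (λ ()) , fork {x = x} {y} {z} x2 y2 (by (zx ⊕ x2) (eq₀ x z))
      (by (y2 ⊗ z0 ⊕ (zx ⊕ zx)) (eq₁ x y z)) (by (z0 ⊗ x2 ⊕ (zy ⊕ zy)) (eq₂ x y z)) hz
    where
    z0 = 0≤-pred {z} 1 z1
    eq₀ : ∀ x z → z - + 2 ≡ (z - x) + (x - + 2)
    eq₀ x z = solve (x ∷ z ∷ [])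
    eq₁ : ∀ x y z → y * z - x - x ≡ (y - + 2) * z + ((z - x) + (z - x))
    eq₁ x y z = solve (x ∷ y ∷ z ∷ [])
    eq₂ : ∀ x y z → z * x - y - y ≡ z * (x - + 2) + ((z - y) + (z - y))
    eq₂ x y z = solve (x ∷ y ∷ z ∷ [])
  ...     | inj₂ lt = good-map (λ {L} T → grow {x = x} {y} {z} x2 y2 zx zy
        (TripleMoves.midᵗ⁺⁺ (Tree L) rotᵀ flipᵀ {x} {y} {z} (0≤-pred {x} 1 x1) (0≤-pred {y} 1 y1) T))
      (good-cyclic n {x} {x * y - z} {y} (by (f ⊕ lt) (eq₁ (+ n) x y z)) x1 (by d1 (eq₂ x y z)) y1)
    where
    eq₁ : ∀ n x y z → n - (x + (x * y - z) + y) ≡ 1ℤ + n - (x + y + z) + (- (x * y - z - z) - 1ℤ)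
    eq₁ n x y z = solve (n ∷ x ∷ y ∷ z ∷ [])
    eq₂ : ∀ x y z → x * y - z - 1ℤ ≡ - (z - x * y) - 1ℤ
    eq₂ x y z = solve (x ∷ y ∷ z ∷ [])

-- Back to quivers

quiver : Triple → Arrows (Fin 3)
quiver (triple p q r) 0F 1F = ∣ p ⊔ 0ℤ ∣
quiver (triple p q r) 1F 0F = ∣ - p ⊔ 0ℤ ∣
quiver (triple p q r) 1F 2F = ∣ q ⊔ 0ℤ ∣
quiver (triple p q r) 2F 1F = ∣ - q ⊔ 0ℤ ∣
quiver (triple p q r) 2F 0F = ∣ r ⊔ 0ℤ ∣
quiver (triple p q r) 0F 2F = ∣ - r ⊔ 0ℤ ∣
quiver _              0F 0F = 0
quiver _              1F 1F = 0
quiver _              2F 2F = 0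

iso-trans : ∀ {n} {a b c : Arrows (Fin n)} → Iso a b → Iso b c → Iso a c
iso-trans (σ , f) (τ , g) = τ ↔-∘ σ , λ i j → trans (g (Inverse.to σ i) (Inverse.to σ j)) (f i j)

iso-sig : ∀ {a} → IsQuiver a → Iso a (quiver (sig a))
iso-sig {a} (d , t) = ↔-id _ , eq
  where
  eq : ∀ i j → quiver (sig a) i j ≡ a i j
  eq 0F 1F = cong ∣_∣ (signed⁺ a (t 0F 1F))
  eq 1F 0F = cong ∣_∣ (-signed⁺ a (t 0F 1F))
  eq 1F 2F = cong ∣_∣ (signed⁺ a (t 1F 2F))
  eq 2F 1F = cong ∣_∣ (-signed⁺ a (t 1F 2F))
  eq 2F 0F = cong ∣_∣ (signed⁺ a (t 2F 0F))
  eq 0F 2F = cong ∣_∣ (-signed⁺ a (t 2F 0F))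
  eq 0F 0F = sym (d 0F)
  eq 1F 1F = sym (d 1F)
  eq 2F 2F = sym (d 2F)

turn unturn swap : Fin 3 → Fin 3
turn 0F = 2F
turn 1F = 0F
turn 2F = 1F
unturn 0F = 1F
unturn 1F = 2F
unturn 2F = 0F
swap 0F = 2F
swap 1F = 1F
swap 2F = 0F

turn↔ swap↔ : Fin 3 ↔ Fin 3
turn↔ = mk↔ₛ′ turn unturn (λ { 0F → refl ; 1F → refl ; 2F → refl }) (λ { 0F → refl ; 1F → refl ; 2F → refl })
swap↔ = mk↔ₛ′ swap swap (λ { 0F → refl ; 1F → refl ; 2F → refl }) (λ { 0F → refl ; 1F → refl ; 2F → refl })

iso-rot : ∀ e → Iso (quiver e) (quiver (rotᵗ e))
iso-rot e = turn↔ , eq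
  where
  eq : ∀ i j → quiver (rotᵗ e) (turn i) (turn j) ≡ quiver e i j
  eq 0F 1F = refl
  eq 1F 0F = refl
  eq 1F 2F = refl
  eq 2F 1F = refl
  eq 2F 0F = refl
  eq 0F 2F = refl
  eq 0F 0F = refl
  eq 1F 1F = refl
  eq 2F 2F = refl

iso-flip : ∀ e → Iso (quiver e) (quiver (flipᵗ e))
iso-flip e@(triple p q r) = swap↔ , eq
  where
  eq : ∀ i j → quiver (flipᵗ e) (swap i) (swap j) ≡ quiver e i j
  eq 0F 1F = cong (λ z → ∣ z ⊔ 0ℤ ∣) (neg-involutive p)
  eq 1F 0F = refl
  eq 1F 2F = cong (λ z → ∣ z ⊔ 0ℤ ∣) (neg-involutive q)
  eq 2F 1F = refl
  eq 2F 0F = cong (λ z → ∣ z ⊔ 0ℤ ∣) (neg-involutive r)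
  eq 0F 2F = refl
  eq 0F 0F = refl
  eq 1F 1F = refl
  eq 2F 2F = refl

orb⇒iso : ∀ {l e} → Orb (_≡ l) e → Iso (quiver e) (quiver l)
orb⇒iso (here refl)     = ↔-id _ , λ _ _ → refl
orb⇒iso {l} {e} (rotᵒ h)  = iso-trans {c = quiver l} (iso-rot e) (orb⇒iso h)
orb⇒iso {l} {e} (flipᵒ h) = iso-trans {c = quiver l} (iso-flip e) (orb⇒iso h)

μᵗ : Fin 3 → Triple → Triple
μᵗ 0F e = rotᵗ (midᵗ (rotᵗ (rotᵗ e)))
μᵗ 1F e = midᵗ e
μᵗ 2F e = rotᵗ (rotᵗ (midᵗ (rotᵗ e)))

sig-μ : ∀ {a} → IsQuiver a → ∀ k → sig (μ k a) ≡ μᵗ k (sig a)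
sig-μ {a} (_ , t) 0F = cong rotᵗ (edges-mid _≟F_ a (λ ()) (λ ()) (t 2F 0F) (t 0F 1F))
sig-μ {a} (_ , t) 1F = edges-mid _≟F_ a (λ ()) (λ ()) (t 0F 1F) (t 1F 2F)
sig-μ {a} (_ , t) 2F = cong (rotᵗ ∘ rotᵗ) (edges-mid _≟F_ a (λ ()) (λ ()) (t 1F 2F) (t 2F 0F))

sig-cong : ∀ {a b} → (∀ i j → a i j ≡ b i j) → sig a ≡ sig b
sig-cong {a} {b} e = triple-cong (s 0F 1F) (s 1F 2F) (s 2F 0F)
  where
  s : ∀ i j → signed a i j ≡ signed b i j
  s i j = cong₂ (λ x y → + x - + y) (e i j) (e j i)

quiver-cong : ∀ {n} {a b : Arrows (Fin n)} → (∀ i j → a i j ≡ b i j) → IsQuiver a → IsQuiver b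
quiver-cong e (d , t) = (λ i → trans (sym (e i i)) (d i))
  , (λ i j → ⊎-map (trans (sym (e i j))) (trans (sym (e j i))) (t i j))

mutSeq-quiver : ∀ {n} ks {a : Arrows (Fin n)} → IsQuiver a → IsQuiver (mutSeq ks a)
mutSeq-quiver []       h = h
mutSeq-quiver (k ∷ ks) h = mutSeq-quiver ks (μ-quiver k h)

mutSeq-∷ʳ : ∀ {n} ks k (a : Arrows (Fin n)) → mutSeq (ks ∷ʳ k) a ≡ μ k (mutSeq ks a)
mutSeq-∷ʳ []       k a = refl
mutSeq-∷ʳ (l ∷ ks) k a = mutSeq-∷ʳ ks k (μ l a)

-- Acyclic and cyclic triples

data AcyclicShape : Triple → Set where
  acyclic : ∀ {p q r} → 0≤ p → 0≤ q → 0≤ - r → AcyclicShape (triple p q r)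

data CyclicShape : Triple → Set where
  cyclic : ∀ {x y z} → 0≤ x - 1ℤ → 0≤ y - 1ℤ → 0≤ z - 1ℤ → CyclicShape (triple x y z)

neg≥0 : ∀ {x} → 0≤ - x - 1ℤ → 0≤ - x
neg≥0 {x} = 0≤-pred { - x} 1

shape : ∀ e → Orb AcyclicShape e ⊎ Orb CyclicShape e
shape (triple x y z) with sign-split x | sign-split y | sign-split z
... | inj₁ x0 | inj₁ y0 | inj₂ z1 = inj₁ (here (acyclic x0 y0 (neg≥0 {z} z1)))
... | inj₁ x0 | inj₂ y1 | inj₁ z0 = inj₁ (rotᵒ (rotᵒ (here (acyclic z0 x0 (neg≥0 {y} y1)))))
... | inj₂ x1 | inj₁ y0 | inj₁ z0 = inj₁ (rotᵒ (here (acyclic y0 z0 (neg≥0 {x} x1))))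
... | inj₂ x1 | inj₂ y1 | inj₁ z0 = inj₁ (flipᵒ (here (acyclic (neg≥0 {y} y1) (neg≥0 {x} x1) (0≤-- z0))))
... | inj₂ x1 | inj₁ y0 | inj₂ z1 = inj₁ (flipᵒ (rotᵒ (here (acyclic (neg≥0 {x} x1) (neg≥0 {z} z1) (0≤-- y0)))))
... | inj₁ x0 | inj₂ y1 | inj₂ z1 = inj₁ (flipᵒ (rotᵒ (rotᵒ (here (acyclic (neg≥0 {z} z1) (neg≥0 {y} y1) (0≤-- x0))))))
... | inj₂ x1 | inj₂ y1 | inj₂ z1 = inj₂ (flipᵒ (here (cyclic y1 x1 z1)))
... | inj₁ x0 | inj₁ y0 | inj₁ z0 with zero-split x0 | zero-split y0 | zero-split z0
...   | inj₂ x1 | inj₂ y1 | inj₂ z1 = inj₂ (here (cyclic x1 y1 z1))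
...   | _ | _ | inj₁ refl = inj₁ (here (acyclic x0 y0 0≤0))
...   | _ | inj₁ refl | _ = inj₁ (rotᵒ (rotᵒ (here (acyclic z0 x0 0≤0))))
...   | inj₁ refl | _ | _ = inj₁ (rotᵒ (here (acyclic y0 z0 0≤0)))

orb-good : ∀ {P : Triple → Set} → (∀ {e} → P e → Good e) → ∀ {e} → Orb P e → Good e
orb-good f (here h)  = f h
orb-good f (rotᵒ h)  = good-map rotᵀ (orb-good f h)
orb-good f (flipᵒ h) = good-map flipᵀ (orb-good f h)

good : ∀ e → Good e
good e with shape e
... | inj₁ h = orb-good (λ { {triple p q r} (acyclic p0 q0 r0) →
      subst (λ z → Good (triple p q z)) (neg-involutive r) (good-acyclic p0 q0 r0) }) h
-- The sum of the multiplicities itself is the initial fuel.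
... | inj₂ h = orb-good (λ { {triple x y z} (cyclic x1 y1 z1) →
      good-cyclic ∣ x + y + z ∣ (bound (total {x} {y} {z} x1 y1 z1)) x1 y1 z1 }) h
  where
  total : ∀ {x y z} → 0≤ x - 1ℤ → 0≤ y - 1ℤ → 0≤ z - 1ℤ → 0≤ x + y + z
  total {x} {y} {z} x1 y1 z1 = 0≤-pred {x} 1 x1 ⊕ 0≤-pred {y} 1 y1 ⊕ 0≤-pred {z} 1 z1
  bound : ∀ {x} → 0≤ x → 0≤ + ∣ x ∣ - x
  bound {+ n} _ = by 0≤0 (eq (+ n))
    where
    eq : ∀ x → x - x ≡ 0ℤ
    eq x = solve (x ∷ [])

tree-shape : ∀ {L e} → Tree L e → Orb Abundant e ⊎ Any (λ l → Orb (_≡ l) e) L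
tree-shape (root m) = inj₂ (Any.map (λ e≡l → here e≡l) m)
tree-shape (fork x2 y2 z2 _ _ _) = inj₁ (here (abundant x2 y2 z2))
tree-shape (grow {x} {y} {z} x2 y2 zx zy _) = inj₁ (here (abundant x2 y2 (by (zx ⊕ x2) (eq x z))))
  where
  eq : ∀ x z → z - + 2 ≡ (z - x) + (x - + 2)
  eq x z = solve (x ∷ z ∷ [])
tree-shape (rotᵀ T)  = ⊎-map rotᵒ (Any.map rotᵒ) (tree-shape T)
tree-shape (flipᵀ T) = ⊎-map flipᵒ (Any.map flipᵒ) (tree-shape T)

tree-μ : ∀ {L e} → Steps (Tree L) e → ∀ k → Tree L (μᵗ k e)
tree-μ (f , g , h) 0F = rotᵀ (rotᵀ h)
tree-μ (f , g , h) 1F = f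
tree-μ (f , g , h) 2F = rotᵀ g

tree-mutSeq : ∀ {L} → (∀ {e} → e ∈ L → Steps (Tree L) e) →
  ∀ ks {a} → IsQuiver a → Tree L (sig a) → Tree L (sig (mutSeq ks a))
tree-mutSeq close []       h T = T
tree-mutSeq {L} close (k ∷ ks) h T = tree-mutSeq close ks (μ-quiver k h)
  (subst (Tree L) (sym (sig-μ h k)) (tree-μ (tree-steps close T) k))

-- A topological order certifies acyclicity and pulls back along isomorphisms without any handling
-- of paths.
Ranked : ∀ {n} → Arrows (Fin n) → Set
Ranked {n} a = Σ (Fin n → ℕ) λ ρ → ∀ i j → a i j ≡ 0 ⊎ ρ i ℕ.< ρ j

ranked⇒acyclic : ∀ {n} {a : Arrows (Fin n)} → Ranked a → Acyclic a
ranked⇒acyclic {a = a} (ρ , h) i c = <-irrefl refl (path-< c)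
  where
  edge-< : ∀ {i j} → 1 ≤ a i j → ρ i ℕ.< ρ j
  edge-< {i} {j} e with h i j
  ... | inj₂ lt = lt
  ... | inj₁ z rewrite z with () ← e
  path-< : ∀ {i j} → Path a i j → ρ i ℕ.< ρ j
  path-< (edge e)   = edge-< e
  path-< (step e p) = <-trans (edge-< e) (path-< p)

iso-ranked : ∀ {n} {a b : Arrows (Fin n)} → Iso a b → Ranked b → Ranked a
iso-ranked (σ , e) (ρ , h) = ρ ∘ Inverse.to σ , λ i j → ⊎-map₁ (trans (sym (e i j))) (h _ _)

shape-ranked : ∀ {e} → AcyclicShape e → Ranked (quiver e)
shape-ranked {triple p q r} (acyclic p0 q0 r0) = toℕ , ok
  where
  ok : ∀ i j → quiver (triple p q r) i j ≡ 0 ⊎ toℕ i ℕ.< toℕ j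
  ok 0F 1F = inj₂ (s≤s z≤n)
  ok 0F 2F = inj₂ (s≤s z≤n)
  ok 1F 2F = inj₂ (s≤s (s≤s z≤n))
  ok 1F 0F = inj₁ (cong ∣_∣ (⁺-nonpos (0≤-- p0)))
  ok 2F 1F = inj₁ (cong ∣_∣ (⁺-nonpos (0≤-- q0)))
  ok 2F 0F = inj₁ (cong ∣_∣ (⁺-nonpos r0))
  ok 0F 0F = inj₁ refl
  ok 1F 1F = inj₁ refl
  ok 2F 2F = inj₁ refl

orb-ranked : ∀ {e} → Orb AcyclicShape e → Ranked (quiver e)
orb-ranked (here h)      = shape-ranked h
orb-ranked {e} (rotᵒ h)  = iso-ranked (iso-rot e) (orb-ranked h)
orb-ranked {e} (flipᵒ h) = iso-ranked (iso-flip e) (orb-ranked h)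

orb-acyclic : ∀ {a} → IsQuiver a → Orb AcyclicShape (sig a) → Acyclic a
orb-acyclic h o = ranked⇒acyclic (iso-ranked (iso-sig h) (orb-ranked o))

-- Quivers one mutation away from an acyclic one

Near : Triple → Set
Near e = Orb AcyclicShape (midᵗ e) ⊎ Orb AcyclicShape (midᵗ (rotᵗ e)) ⊎ Orb AcyclicShape (midᵗ (rotᵗ (rotᵗ e)))

near-rot : ∀ {e} → Near (rotᵗ e) → Near e
near-rot (inj₁ h)        = inj₂ (inj₁ h)
near-rot (inj₂ (inj₁ h)) = inj₂ (inj₂ h)
near-rot (inj₂ (inj₂ h)) = inj₁ h

near-flip : ∀ {e} → Near (flipᵗ e) → Near e
near-flip {e} n = go n
  where
  un : ∀ e → Orb AcyclicShape (midᵗ (flipᵗ e)) → Orb AcyclicShape (midᵗ e)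
  un e h = flipᵒ (subst (Orb AcyclicShape) (midᵗ-flip e) h)
  go : Near (flipᵗ e) → Near e
  go (inj₁ h)        = inj₁ (un e h)
  go (inj₂ (inj₁ h)) = inj₂ (inj₂ (un (rotᵗ (rotᵗ e)) h))
  go (inj₂ (inj₂ h)) = inj₂ (inj₁ (un (rotᵗ e) h))

-- With a simple arrow, one mutation replaces z by y - z and another replaces y by z - y; whichever
-- is nonpositive breaks the cycle.
near-one : ∀ {y z} → 0≤ y - 1ℤ → 0≤ z - 1ℤ → Near (triple 1ℤ y z)
near-one {y} {z} y1 z1 = go (sign-split (z - y))
  where
  open TripleMoves (Orb AcyclicShape) rotᵒ flipᵒ
  y0 : 0≤ y
  y0 = 0≤-pred 1 y1
  z0 : 0≤ z
  z0 = 0≤-pred 1 z1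
  eq₁ : ∀ y z → - (1ℤ * y - z) ≡ z - y
  eq₁ y z = solve (y ∷ z ∷ [])
  eq₂ : ∀ y z → - (z * 1ℤ - y) ≡ - (z - y) - 1ℤ + 1ℤ
  eq₂ y z = solve (y ∷ z ∷ [])
  go : 0≤ z - y ⊎ 0≤ - (z - y) - 1ℤ → Near (triple 1ℤ y z)
  go (inj₁ h) = inj₁ (midᵗ⁺⁺ {1ℤ} {y} {z} 0≤1 y0 (rotᵒ (rotᵒ (here (acyclic y0 0≤1 (by h (eq₁ y z)))))))
  go (inj₂ h) = inj₂ (inj₂ (midᵗ⁺⁺ {z} {1ℤ} {y} z0 0≤1 (rotᵒ (rotᵒ (here (acyclic 0≤1 z0 (by (h ⊕ 0≤1) (eq₂ y z))))))))

near-cyclic : ∀ {e} → Orb CyclicShape e → Orb Abundant e ⊎ Near e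
near-cyclic (here (cyclic {x} {y} {z} x1 y1 z1)) = go (one-split x1) (one-split y1) (one-split z1)
  where
  go : x ≡ 1ℤ ⊎ 0≤ x - + 2 → y ≡ 1ℤ ⊎ 0≤ y - + 2 → z ≡ 1ℤ ⊎ 0≤ z - + 2 →
    Orb Abundant (triple x y z) ⊎ Near (triple x y z)
  go (inj₁ refl) _           _           = inj₂ (near-one y1 z1)
  go _           (inj₁ refl) _           = inj₂ (near-rot (near-one z1 x1))
  go _           _           (inj₁ refl) = inj₂ (near-rot (near-rot (near-one x1 y1)))
  go (inj₂ x2)   (inj₂ y2)   (inj₂ z2)   = inj₁ (here (abundant x2 y2 z2))
near-cyclic (rotᵒ h)  = ⊎-map rotᵒ near-rot (near-cyclic h)
near-cyclic (flipᵒ h) = ⊎-map flipᵒ near-flip (near-cyclic h)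

near-μ : ∀ {e} → Near e → Σ (Fin 3) λ k → Orb AcyclicShape (μᵗ k e)
near-μ (inj₁ h)        = 1F , h
near-μ (inj₂ (inj₁ h)) = 2F , rotᵒ h
near-μ (inj₂ (inj₂ h)) = 0F , rotᵒ (rotᵒ h)

¬abundant⇒mutationAcyclic : ∀ {a} ks → IsQuiver a → ¬ Orb Abundant (sig (mutSeq ks a)) → MutationAcyclic a
¬abundant⇒mutationAcyclic {a} ks q ¬ab with mutSeq-quiver ks q | shape (sig (mutSeq ks a))
... | q′ | inj₁ o = mutSeq ks a , (ks , λ _ _ → refl) , orb-acyclic q′ o
... | q′ | inj₂ o with near-cyclic o
...   | inj₁ ab = ⊥-elim (¬ab ab)
...   | inj₂ n with near-μ n
...     | k , o′ = μ k (mutSeq ks a) , (ks ∷ʳ k , λ i j → cong (λ m → m i j) (mutSeq-∷ʳ ks k a))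
        , orb-acyclic (μ-quiver k q′) (subst (Orb AcyclicShape) (sym (sig-μ q′ k)) o′)

theorem7p2 : (a : Arrows (Fin 3)) → IsQuiver a →
    ((¬ MutationAcyclic a) → ∀ b → InMut a b → ¬ HasMGS b)
    × Σ (List (Arrows (Fin 3))) (λ L → (length L ≤ 6)
    × (∀ b → InMut a b → HasMGS b → Any (Iso b) L))
theorem7p2 a q with good (sig a)
... | L , l≤6 , close , T =
    -- By contraposition: a member with a maximal green sequence is not abundant, so it is acyclic
    -- or one mutation away from an acyclic quiver.
    (λ ¬ma b (ks , e) mgs → ¬ma (¬abundant⇒mutationAcyclic ks q (λ ab → ¬abundant b ks e mgs ab)))
  , map quiver L , subst (_≤ 6) (sym (length-map quiver L)) l≤6 , candidates
  where
  reached : ∀ b ks → (∀ i j → mutSeq ks a i j ≡ b i j) → IsQuiver b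
  reached b ks e = quiver-cong e (mutSeq-quiver ks q)
  ¬abundant : ∀ b ks → (∀ i j → mutSeq ks a i j ≡ b i j) → HasMGS b → ¬ Orb Abundant (sig (mutSeq ks a))
  ¬abundant b ks e mgs ab = abundant⇒¬mgs (reached b ks e) (subst (Orb Abundant) (sig-cong e) ab) mgs
  candidates : ∀ b → InMut a b → HasMGS b → Any (Iso b) (map quiver L)
  candidates b (ks , e) mgs with tree-shape (tree-mutSeq close ks q T)
  ... | inj₁ ab = ⊥-elim (¬abundant b ks e mgs ab)
  ... | inj₂ m  = map⁺ (Any.map (λ {l} o → iso-trans {c = quiver l} (iso-sig (reached b ks e))
          (orb⇒iso (subst (Orb (_≡ l)) (sig-cong e) o))) m)
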